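{- Let $$A(t_1,t_2,t_3,t_4,r,s,x,v,w;z):=\sum_{n\ge 1}\sum_{W\in\mathfrak L_n}t_1^{\mathrm{sdeb}(W)}t_2^{\mathrm{sdea}(W)}t_3^{\mathrm{neb}(W)}t_4^{\mathrm{nea}(W)}r^{\mathrm{nde}(W)}s^{\mathrm{asc}(W)}x^{\mathrm{cs}(W)}v^{\mathrm{ht}(W)}w^{\mathrm{wt}(W)}z^n .$$ Then $$A(t_1,t_2,t_3,t_4,r,s,x,v,w;z)=\frac{x}{rs}\,A\Big(t_4,\frac{t_3}{vw},vwt_2,t_1,\frac1r,\frac1s,\frac1x,v,w;\,rsxz\Big)$$ as formal power series in $z$ whose coefficients are Laurent polynomials in the other variables.
   Context: $[n]=\{1,\dots,n\}$. A 2-Motzkin path of length $n$ is a word $w=w_1\cdots w_n$ over the alphabet $\{\mathrm N,\mathrm S,\mathrm E,\mathrm{dE}\}$ such that, with $h_i:=\#\{j<i: w_j=\mathrm N\}-\#\{j<i: w_j=\mathrm S\}$ for $1\le i\le n+1$, one has $h_i\ge 0$ for all $i$ and $h_{n+1}=0$. An sr-Laguerre history of length $n$ is a triple $W=(w,h,c)$ where $w$ is a 2-Motzkin path of length $n$, $h=h_1\cdots h_n$ is its height sequence, and $c=c_1\cdots c_n$ is a sequence of integers with $0\le c_i\le h_i$ if $w_i\in\{\mathrm N,\mathrm E\}$ and $1\le c_i\le h_i$ if $w_i\in\{\mathrm S,\mathrm{dE}\}$. $\mathfrak L_n$ is the set of all of these. Put $\mathrm{cs}(W):=\max\{i\in[n]: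 c_i=0\}$. With $m=\mathrm{cs}(W)$, the statistics are: $\mathrm{neb}(W)=\#\{i<m: w_i\in\{\mathrm N,\mathrm E\}\}$, $\mathrm{nea}(W)=\#\{i>m: w_i\in\{\mathrm N,\mathrm E\}\}$, $\mathrm{sdeb}(W)=\#\{i<m: w_i\in\{\mathrm S,\mathrm{dE}\}\}$, $\mathrm{sdea}(W)=\#\{i>m: w_i\in\{\mathrm S,\mathrm{dE}\}\}$, $\mathrm{nde}(W)=\#\{i\in[n-1]: w_i\in\{\mathrm N,\mathrm{dE}\}\}$, $\mathrm{ht}(W)=\sum_{i=1}^n h_i$, $\mathrm{wt}(W)=\sum_{i=1}^n c_i$, and $\mathrm{asc}(W)$ is the number of $i\in[n-1]$ such that either $w_i\in\{\mathrm N,\mathrm E\}$ and $c_i<c_{i+1}$, or $w_i\in\{\mathrm S,\mathrm{dE}\}$ and $c_i\le c_{i+1}$. (The variable $w$ in $A$ is unrelated to the path $w$.) -}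

module Defs where

open import Algebra.Bundles.Raw using (RawSemiring)
import Algebra.Definitions.RawSemiring as RawSemiringDefinitions
open import Data.Fin.Base as Fin using (Fin; toℕ; fromℕ; inject₁)
open import Data.Fin using (#_)
import Data.Fin.Properties as Fin
open import Data.Integer.Base as ℤ using (ℤ; 0ℤ; 1ℤ; -1ℤ; +_; _⊖_; ∣_∣)
import Data.Integer.Properties as ℤ
open import Data.List.Base as List using (List; []; _∷_; _++_; filter; length; allFin; upTo; cartesianProduct; cartesianProductWith)
open import Data.List.Extrema.Nat using (max)
import Data.List.Properties as List
open import Data.List.Membership.Propositional using (_∈_)
open import Data.List.Membership.Propositional.Properties using (∈-filter⁺; ∈-filter⁻; ∈-cartesianProduct⁺; ∈-cartesianProductWith⁺; ∈-upTo⁺)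
open import Data.List.Relation.Unary.All using ([]; _∷_)
open import Data.List.Relation.Unary.Any using (here; there)
open import Data.List.Relation.Unary.AllPairs using ([]; _∷_)
open import Data.List.Relation.Unary.Unique.Propositional using (Unique)
import Data.List.Relation.Unary.Unique.Propositional.Properties as Unique
open import Data.Nat.Base as ℕ using (ℕ; zero; suc; _≤_; _<_; s≤s)
open import Data.Nat.ListAction using (sum)
import Data.Nat.Properties as ℕ
open import Data.Product.Base using (_×_; _,_; proj₁; proj₂)
open import Data.Sum.Base using (_⊎_; inj₁; inj₂)
open import Data.Vec.Base as Vec using (Vec; []; _∷_; lookup; replicate; zipWith; tabulate)
import Data.Vec.Properties as Vec
open import Function.Base using (_∘_)
open import Function.Bundles using (_⇔_; mk⇔)
open import Level using (0ℓ)
open import Relation.Binary.Definitions using (DecidableEquality)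
open import Relation.Binary.PropositionalEquality
open import Relation.Nullary.Decidable using (yes; no; _×-dec_; _⊎-dec_)
open import Relation.Unary using (Pred; Decidable)

------------------------------------------------------------------------
-- 2-Motzkin paths and sr-Laguerre histories

data Letter : Set where
  N S E dE : Letter

_≟ᴸ_ : DecidableEquality Letter
N  ≟ᴸ N  = yes refl
N  ≟ᴸ S  = no λ ()
N  ≟ᴸ E  = no λ ()
N  ≟ᴸ dE = no λ ()
S  ≟ᴸ N  = no λ ()
S  ≟ᴸ S  = yes refl
S  ≟ᴸ E  = no λ ()
S  ≟ᴸ dE = no λ ()
E  ≟ᴸ N  = no λ ()
E  ≟ᴸ S  = no λ ()
E  ≟ᴸ E  = yes refl
E  ≟ᴸ dE = no λ ()
dE ≟ᴸ N  = no λ ()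
dE ≟ᴸ S  = no λ ()
dE ≟ᴸ E  = no λ ()
dE ≟ᴸ dE = yes refl

_isNorE _isSordE _isNordE : Letter → Set
l isNorE  = l ≡ N ⊎ l ≡ E
l isSordE = l ≡ S ⊎ l ≡ dE
l isNordE = l ≡ N ⊎ l ≡ dE

_isNorE? : Decidable _isNorE
l isNorE? = (l ≟ᴸ N) ⊎-dec (l ≟ᴸ E)

_isSordE? : Decidable _isSordE
l isSordE? = (l ≟ᴸ S) ⊎-dec (l ≟ᴸ dE)

_isNordE? : Decidable _isNordE
l isNordE? = (l ≟ᴸ N) ⊎-dec (l ≟ᴸ dE)

-- The index i : Fin n stands for position suc (toℕ i) of a word of length n.

countFin : ∀ {n} {P : Pred (Fin n) 0ℓ} → Decidable P → ℕ
countFin P? = length (filter P? (allFin _))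

sumFin : ∀ {n} → (Fin n → ℕ) → ℕ
sumFin f = sum (List.map f (allFin _))

occurrencesBefore : ∀ {n} → Letter → Vec Letter n → Fin (suc n) → ℕ
occurrencesBefore l w i =
  countFin (λ j → (toℕ j ℕ.<? toℕ i) ×-dec (lookup w j ≟ᴸ l))

-- i ranges over Fin (suc n) because h_{n+1}, the final height, is included.
height : ∀ {n} → Vec Letter n → Fin (suc n) → ℤ
height w i = occurrencesBefore N w i ⊖ occurrencesBefore S w i

Is2Motzkin : ∀ {n} → Vec Letter n → Set
Is2Motzkin {n} w = (∀ i → 0ℤ ℤ.≤ height w i) × height w (fromℕ n) ≡ 0ℤ

-- A triple (w, h, c) is represented by (w, c), as h is determined by w.  The
-- entries of c are naturals since every admissible label satisfies 0 ≤ c_i.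
Labelled : ℕ → Set
Labelled n = Vec Letter n × Vec ℕ n

LabelOK : Letter → ℤ → ℕ → Set
LabelOK l h c = (l isNorE  × + c ℤ.≤ h)
              ⊎ (l isSordE × 1 ≤ c × + c ℤ.≤ h)

IsHistory : ∀ {n} → Labelled n → Set
IsHistory (w , c) =
  Is2Motzkin w × (∀ i → LabelOK (lookup w i) (height w (inject₁ i)) (lookup c i))

isHistory? : ∀ {n} → Decidable (IsHistory {n})
isHistory? {n} (w , c) =
  (Fin.all? (λ i → 0ℤ ℤ.≤? height w i) ×-dec (height w (fromℕ n) ℤ.≟ 0ℤ))
  ×-dec Fin.all? λ i →
    let l = lookup w i ; h = height w (inject₁ i) ; cᵢ = lookup c i in
    ((l isNorE?) ×-dec (+ cᵢ ℤ.≤? h))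
    ⊎-dec ((l isSordE?) ×-dec (1 ℕ.≤? cᵢ) ×-dec (+ cᵢ ℤ.≤? h))

tuples : ∀ {A : Set} → List A → ∀ n → List (Vec A n)
tuples as zero    = [] ∷ []
tuples as (suc n) = cartesianProductWith _∷_ as (tuples as n)

letters : List Letter
letters = N ∷ S ∷ E ∷ dE ∷ []

-- No label exceeds n, because h_i ≤ n; ∈-𝔏 and 𝔏-unique below show that
-- this lists every history exactly once.
𝔏 : ∀ n → List (Labelled n)
𝔏 n = filter isHistory? (cartesianProduct (tuples letters n) (tuples (upTo (suc n)) n))

private
  ∈-tuples : ∀ {A : Set} {as : List A} {n} (u : Vec A n) →
             (∀ i → lookup u i ∈ as) → u ∈ tuples as n
  ∈-tuples []      _ = here refl
  ∈-tuples (a ∷ u) p =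
    ∈-cartesianProductWith⁺ _∷_ (p Fin.zero) (∈-tuples u (p ∘ Fin.suc))

  tuples-unique : ∀ {A : Set} {as : List A} → Unique as → ∀ n → Unique (tuples as n)
  tuples-unique p zero    = [] ∷ []
  tuples-unique p (suc n) =
    Unique.cartesianProductWith⁺ _∷_ Vec.∷-injective p (tuples-unique p n)

  ∈-letters : ∀ l → l ∈ letters
  ∈-letters N  = here refl
  ∈-letters S  = there (here refl)
  ∈-letters E  = there (there (here refl))
  ∈-letters dE = there (there (there (here refl)))

  letters-unique : Unique letters
  letters-unique = ((λ ()) ∷ (λ ()) ∷ (λ ()) ∷ []) ∷ ((λ ()) ∷ (λ ()) ∷ [])
                 ∷ ((λ ()) ∷ []) ∷ [] ∷ []

  height≤n : ∀ {n} (w : Vec Letter n) i → height w i ℤ.≤ + n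
  height≤n {n} w i = ℤ.≤-trans (ℤ.m⊖n≤m (occurrencesBefore N w i) (occurrencesBefore S w i))
    (ℤ.+≤+ (ℕ.≤-trans (List.length-filter _ (allFin n))
                      (ℕ.≤-reflexive (List.length-tabulate {n = n} (λ j → j)))))

  label≤height : ∀ {l h c} → LabelOK l h c → + c ℤ.≤ h
  label≤height (inj₁ (_ , q))     = q
  label≤height (inj₂ (_ , _ , q)) = q

∈-𝔏 : ∀ {n} (W : Labelled n) → W ∈ 𝔏 n ⇔ IsHistory W
∈-𝔏 {n} (w , c) = mk⇔
  (λ p → proj₂ (∈-filter⁻ isHistory? {xs = candidates} p))
  (λ H → ∈-filter⁺ isHistory?
    (∈-cartesianProduct⁺
      (∈-tuples w (λ i → ∈-letters (lookup w i)))
      (∈-tuples c (λ i → ∈-upTo⁺ (s≤s (ℤ.drop‿+≤+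
        (ℤ.≤-trans (label≤height (proj₂ H i)) (height≤n w (inject₁ i))))))))
    H)
  where
  candidates : List (Labelled n)
  candidates = cartesianProduct (tuples letters n) (tuples (upTo (suc n)) n)

𝔏-unique : ∀ n → Unique (𝔏 n)
𝔏-unique n = Unique.filter⁺ isHistory?
  (Unique.cartesianProduct⁺ (tuples-unique letters-unique n)
                            (tuples-unique (Unique.upTo⁺ (suc n)) n))

------------------------------------------------------------------------
-- Statistics

-- For a history of positive length the maximum is over a nonempty set, since
-- h_1 = 0 forces c_1 = 0; the default value 0 is then never used.
cs : ∀ {n} → Labelled n → ℕ
cs {n} (_ , c) =
  max 0 (List.map (suc ∘ toℕ) (filter (λ i → lookup c i ℕ.≟ 0) (allFin n)))

module _ {n} (W : Labelled n) where

  private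
    w = proj₁ W
    c = proj₂ W

  neb nea sdeb sdea ht wt : ℕ
  neb  = countFin λ i → (suc (toℕ i) ℕ.<? cs W) ×-dec (lookup w i isNorE?)
  nea  = countFin λ i → (cs W ℕ.<? suc (toℕ i)) ×-dec (lookup w i isNorE?)
  sdeb = countFin λ i → (suc (toℕ i) ℕ.<? cs W) ×-dec (lookup w i isSordE?)
  sdea = countFin λ i → (cs W ℕ.<? suc (toℕ i)) ×-dec (lookup w i isSordE?)
  -- ∣_∣ only serves as the coercion to ℕ: heights of a history are nonnegative.
  ht   = sumFin λ i → ∣ height w (inject₁ i) ∣
  wt   = sumFin λ i → lookup c i

-- For length n = suc m, position i ∈ [n-1] is given by i : Fin m, with
-- inject₁ i and Fin.suc i being the positions i and i+1 in the word.
module _ {m} (W : Labelled (suc m)) where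

  private
    w = proj₁ W
    c = proj₂ W

  nde asc : ℕ
  nde = countFin {m} λ i → lookup w (inject₁ i) isNordE?
  asc = countFin {m} λ i →
    let wᵢ = lookup w (inject₁ i) ; cᵢ = lookup c (inject₁ i) ; cᵢ₊₁ = lookup c (Fin.suc i) in
    ((wᵢ isNorE?) ×-dec (cᵢ ℕ.<? cᵢ₊₁)) ⊎-dec ((wᵢ isSordE?) ×-dec (cᵢ ℕ.≤? cᵢ₊₁))

------------------------------------------------------------------------
-- Laurent polynomials over ℤ in k variables

-- A formal sum of terms (coefficient , exponent vector); terms may repeat, and
-- equality _≈_ compares the total coefficient of every monomial.
Laurent : ℕ → Set
Laurent k = List (ℤ × Vec ℤ k)

coeff : ∀ {k} → Laurent k → Vec ℤ k → ℤ
coeff p e =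
  List.foldr ℤ._+_ 0ℤ (List.map proj₁ (filter (λ t → Vec.≡-dec ℤ._≟_ (proj₂ t) e) p))

laurent : ℕ → RawSemiring 0ℓ 0ℓ
laurent k = record
  { Carrier = Laurent k
  ; _≈_     = λ p q → ∀ e → coeff p e ≡ coeff q e
  ; _+_     = _++_
  ; _*_     = cartesianProductWith λ (a , e) (b , f) → a ℤ.* b , zipWith ℤ._+_ e f
  ; 0#      = []
  ; 1#      = (1ℤ , replicate k 0ℤ) ∷ []
  }

infix 9 _^var_
_^var_ : ∀ {k} → Fin k → ℤ → Laurent k
i ^var d = (1ℤ , (replicate _ 0ℤ Vec.[ i ]≔ d)) ∷ []

^var-inverse : ∀ {k} (i : Fin k) d →
               RawSemiring._*_ (laurent k) (i ^var d) (i ^var (ℤ.- d)) ≡ RawSemiring.1# (laurent k)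
^var-inverse i d = cong (λ e → (1ℤ , e) ∷ []) (go i)
  where
  zeros : ∀ n → zipWith ℤ._+_ (replicate n 0ℤ) (replicate n 0ℤ) ≡ replicate n 0ℤ
  zeros n = Vec.zipWith-replicate ℤ._+_ 0ℤ 0ℤ
  go : ∀ {n} (i : Fin n) →
       zipWith ℤ._+_ (replicate n 0ℤ Vec.[ i ]≔ d) (replicate n 0ℤ Vec.[ i ]≔ (ℤ.- d)) ≡ replicate n 0ℤ
  go {suc n} Fin.zero    = cong₂ _∷_ (ℤ.+-inverseʳ d) (zeros n)
  go {suc n} (Fin.suc i) = cong (0ℤ ∷_) (go i)

open RawSemiring (laurent 9) public using (_≈_; _+_; _*_; 0#; 1#)
open RawSemiringDefinitions (laurent 9) public using (_^_)

t₁ t₂ t₃ t₄ r s x v w : Laurent 9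
t₁ = # 0 ^var 1ℤ
t₂ = # 1 ^var 1ℤ
t₃ = # 2 ^var 1ℤ
t₄ = # 3 ^var 1ℤ
r  = # 4 ^var 1ℤ
s  = # 5 ^var 1ℤ
x  = # 6 ^var 1ℤ
v  = # 7 ^var 1ℤ
w  = # 8 ^var 1ℤ

r⁻¹ s⁻¹ x⁻¹ v⁻¹ w⁻¹ : Laurent 9
r⁻¹ = # 4 ^var -1ℤ
s⁻¹ = # 5 ^var -1ℤ
x⁻¹ = # 6 ^var -1ℤ
v⁻¹ = # 7 ^var -1ℤ
w⁻¹ = # 8 ^var -1ℤ

------------------------------------------------------------------------
-- Formal power series in z

-- F n is the coefficient of z^n.
Series : Set
Series = ℕ → Laurent 9

infix 4 _≋_
_≋_ : Series → Series → Set
F ≋ G = ∀ n → F n ≈ G n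

infixr 7 _·_
_·_ : Laurent 9 → Series → Series
(a · F) n = a * F n

-- F [ a z] is the series F(az).
infix 8 _[_z]
_[_z] : Series → Laurent 9 → Series
(F [ a z]) n = (a ^ n) * F n

∑ : ∀ {X : Set} → List X → (X → Laurent 9) → Laurent 9
∑ Xs f = List.foldr _+_ 0# (List.map f Xs)

-- The generating function with arbitrary Laurent polynomials substituted for
-- its nine variables other than z; A itself is A t₁ t₂ t₃ t₄ r s x v w.
A : (t₁ t₂ t₃ t₄ r s x v w : Laurent 9) → Series
A t₁ t₂ t₃ t₄ r s x v w zero        = 0#
A t₁ t₂ t₃ t₄ r s x v w n@(suc _) = ∑ (𝔏 n) λ W →
    t₁ ^ sdeb W * t₂ ^ sdea W * t₃ ^ neb W * t₄ ^ nea W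
  * r ^ nde W * s ^ asc W * x ^ cs W * v ^ ht W * w ^ wt W

{-# OPTIONS --safe #-}

-- Encode a letter by the bits a = [letter ∈ {N, dE}] and b = [letter ∈ {N, E}],
-- so that it changes the height by a + b − 1, and position i is an ascent iff
-- cᵢ + bᵢ ≤ cᵢ₊₁.  Let p = cs(W); there cₚ = 0 and hence bₚ = 1, while the last a
-- is always 0.  Put k = n + 1 − i.  Reversing the word, with
--   a′ᵢ = 1 − aₖ₋₁ for k > 1,  b′ᵢ = 1 − bₖ for k ≠ p,  b′ᵢ = 1 for k = p,
--   c′ᵢ = cₖ + bₖ − [k ≥ p],
-- changes the heights to h′ᵢ = hₖ + bₖ − [k ≥ p].  This is an involution on
-- histories which sends p to n + 1 − p, exchanges N/E before p with S/dE after p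
-- and vice versa, and complements nde and asc; ht and wt both change by
-- neb − sdea.  Hence it matches the two sides term by term.

module Submission where

open import Data.Bool.Base using (Bool; true; false; not; _∧_; _∨_)
import Data.Bool.Properties as Bool
open import Data.Fin.Base as Fin using (Fin; zero; suc; toℕ; fromℕ; inject₁; opposite)
open import Data.Fin.Induction using (<-weakInduction)
import Data.Fin.Properties as Fin
open import Data.Fin.Relation.Unary.Top using (view; ‵fromℕ; ‵inject₁)
open import Data.Integer.Base as ℤ using (ℤ; 0ℤ; 1ℤ; -1ℤ; +_; _⊖_; ∣_∣)
import Data.Integer.Properties as ℤ
open import Algebra.Properties.AbelianGroup ℤ.+-0-abelianGroup using (∙-cancelʳ)
open import Data.Integer.Tactic.RingSolver using (solve-∀)
open import Data.List.Base as List using (List; []; _∷_; map; allFin; filter; length)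
open import Data.List.Extrema.Nat using (xs≤max; max≤v⁺; argmax-sel)
open import Data.List.Membership.Propositional using (_∈_)
open import Data.List.Membership.Propositional.Properties
  using (∈-map⁺; ∈-map⁻; ∈-filter⁺; ∈-filter⁻; ∈-allFin)
open import Data.List.Membership.Propositional.Properties.WithK using (unique∧set⇒bag)
import Data.List.Properties as List
open import Data.List.Relation.Binary.BagAndSetEquality using (∼bag⇒↭)
open import Data.List.Relation.Binary.Permutation.Propositional using (_↭_; ↭⇒↭ₛ)
import Data.List.Relation.Binary.Permutation.Propositional.Properties as ↭
import Data.List.Relation.Binary.Permutation.Setoid.Properties as ↭ₛ
import Data.List.Relation.Unary.All as All
open import Data.List.Relation.Unary.Unique.Propositional using (Unique)
import Data.List.Relation.Unary.Unique.Propositional.Properties as Unique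
open import Data.Nat.Base as ℕ using (ℕ; zero; suc; _≤_; _<_; s≤s; z≤n)
open import Data.Nat.ListAction using (sum)
open import Data.Nat.ListAction.Properties using (sum-↭)
import Data.Nat.Properties as ℕ
import Data.Nat.Tactic.RingSolver as ℕ
open import Data.Product.Base using (_×_; _,_; proj₁; proj₂; ∃-syntax)
open import Data.Sum.Base using (_⊎_; inj₁; inj₂)
open import Data.Vec.Base as Vec using (Vec; []; _∷_; lookup; tabulate)
import Data.Vec.Properties as Vec
open import Function.Base using (_∘_; id)
open import Function.Bundles using (_⇔_; mk⇔; Equivalence)
open import Level using (0ℓ)
open import Relation.Binary.Definitions using (tri<; tri≈; tri>)
open import Relation.Binary.PropositionalEquality
open import Relation.Nullary.Decidable
  using (does; _×-dec_; _⊎-dec_; dec-true; dec-false; does-⇔; ¬?)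
open import Relation.Nullary.Negation using (contradiction; ¬_)
open import Relation.Unary using (Pred; Decidable)

open import Defs

-- Involutions as permutations of a list

involution⇒↭ : ∀ {X : Set} {f : X → X} {xs : List X} → Unique xs →
               (∀ {a} → a ∈ xs → f a ∈ xs) → (∀ {a} → a ∈ xs → f (f a) ≡ a) →
               map f xs ↭ xs
involution⇒↭ {f = f} {xs} xs! closed invol =
  -- Injectivity of `f` is needed only on `xs`: `map f xs` inherits uniqueness from
  -- `map f (map f xs) ≡ xs`, and duplicate-free lists with the same members agree as bags.
  ∼bag⇒↭ (unique∧set⇒bag (Unique.map⁻ {f = f} (subst Unique (sym ff≡id) xs!)) xs! (mk⇔ to from))
  where
  ff≡id : map f (map f xs) ≡ xs
  ff≡id = trans (sym (List.map-∘ xs)) (List.map-id-local (All.tabulate invol))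

  to : ∀ {a} → a ∈ map f xs → a ∈ xs
  to p with b , b∈xs , refl ← ∈-map⁻ f p = closed b∈xs

  from : ∀ {a} → a ∈ xs → a ∈ map f xs
  from p = subst (_∈ map f xs) (invol p) (∈-map⁺ f (closed p))

-- A coefficient is a fold of a commutative operation over a filtered list, so the order of the
-- terms is immaterial. This is what turns a rearrangement of the histories into an equality of
-- generating functions.
coeff-↭ : ∀ {k} {p q : Laurent k} → p ↭ q → ∀ e → coeff p e ≡ coeff q e
coeff-↭ p↭q e = ↭ₛ.foldr-commMonoid (setoid ℤ) ℤ.+-0-isCommutativeMonoid
  (↭⇒↭ₛ (↭.map⁺ proj₁ (↭.filter-↭ (λ t → Vec.≡-dec ℤ._≟_ (proj₂ t) e) p↭q)))

-- Counting over Fin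

bit : Bool → ℕ
bit true  = 1
bit false = 0

bit-not : ∀ b → bit (not b) ℕ.+ bit b ≡ 1
bit-not true  = refl
bit-not false = refl

sumFin-suc : ∀ {n} (f : Fin (suc n) → ℕ) → sumFin f ≡ f zero ℕ.+ sumFin (f ∘ suc)
sumFin-suc f = cong (λ xs → f zero ℕ.+ sum xs)
  (trans (List.map-tabulate suc f) (sym (List.map-tabulate id (f ∘ suc))))

sumFin-cong : ∀ {n} {f g : Fin n → ℕ} → f ≗ g → sumFin f ≡ sumFin g
sumFin-cong f≗g = cong sum (List.map-cong f≗g (allFin _))

sumFin-+ : ∀ {n} (f g : Fin n → ℕ) → sumFin (λ i → f i ℕ.+ g i) ≡ sumFin f ℕ.+ sumFin g
sumFin-+ {zero}  f g = refl
sumFin-+ {suc n} f g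
  rewrite sumFin-suc (λ i → f i ℕ.+ g i) | sumFin-suc f | sumFin-suc g
        | sumFin-+ (f ∘ suc) (g ∘ suc) = shuffle (f zero) (g zero) _ _
  where
  shuffle : ∀ a b c d → a ℕ.+ b ℕ.+ (c ℕ.+ d) ≡ a ℕ.+ c ℕ.+ (b ℕ.+ d)
  shuffle = ℕ.solve-∀

sumFin-one : ∀ n → sumFin {n} (λ _ → 1) ≡ n
sumFin-one zero    = refl
sumFin-one (suc n) = trans (sumFin-suc {n} (λ _ → 1)) (cong suc (sumFin-one n))

sumFin-opposite : ∀ {n} (f : Fin n → ℕ) → sumFin (f ∘ opposite) ≡ sumFin f
sumFin-opposite {n} f = trans (cong sum (List.map-∘ (allFin n)))
  (sum-↭ (↭.map⁺ f (involution⇒↭ (Unique.allFin⁺ n) (λ _ → ∈-allFin _)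
                                  (λ {i} _ → Fin.opposite-involutive i))))

countFin-sum : ∀ {n} {P : Pred (Fin n) 0ℓ} (P? : Decidable P) →
               countFin P? ≡ sumFin (λ i → bit (does (P? i)))
countFin-sum {P = P} P? = go (allFin _)
  where
  go : ∀ is → length (filter P? is) ≡ sum (map (λ i → bit (does (P? i))) is)
  go []       = refl
  go (i ∷ is) with does (P? i)
  ... | true  = cong suc (go is)
  ... | false = go is

module _ {n : ℕ} {P Q : Pred (Fin n) 0ℓ} (P? : Decidable P) (Q? : Decidable Q) where

  countFin-reflect : (∀ i → does (P? (opposite i)) ≡ does (Q? i)) → countFin P? ≡ countFin Q?
  countFin-reflect P≡Q = begin
    countFin P?
      ≡⟨ countFin-sum P? ⟩
    sumFin (λ i → bit (does (P? i)))
      ≡⟨ sumFin-opposite (λ i → bit (does (P? i))) ⟨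
    sumFin (λ i → bit (does (P? (opposite i))))
      ≡⟨ sumFin-cong (cong bit ∘ P≡Q) ⟩
    sumFin (λ i → bit (does (Q? i)))
      ≡⟨ countFin-sum Q? ⟨
    countFin Q? ∎
    where open ≡-Reasoning

  -- Once the first count is reversed, the two indicator bits at each position add up to 1.
  countFin-complement : (∀ i → does (P? (opposite i)) ≡ not (does (Q? i))) →
                        countFin P? ℕ.+ countFin Q? ≡ n
  countFin-complement P≡¬Q = begin
    countFin P? ℕ.+ countFin Q?
      ≡⟨ cong₂ ℕ._+_ (trans (countFin-sum P?) (sym (sumFin-opposite (λ i → bit (does (P? i)))))) (countFin-sum Q?) ⟩
    sumFin (λ i → bit (does (P? (opposite i)))) ℕ.+ sumFin (λ i → bit (does (Q? i)))
      ≡⟨ sumFin-+ (λ i → bit (does (P? (opposite i)))) (λ i → bit (does (Q? i))) ⟨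
    sumFin (λ i → bit (does (P? (opposite i))) ℕ.+ bit (does (Q? i)))
      ≡⟨ sumFin-cong (λ i → trans (cong (λ b → bit b ℕ.+ _) (P≡¬Q i)) (bit-not (does (Q? i)))) ⟩
    sumFin {n} (λ _ → 1)
      ≡⟨ sumFin-one n ⟩
    n ∎
    where
    open ≡-Reasoning

-- Heights of histories

α β : Letter → Bool
α l = does (l isNordE?)
β l = does (l isNorE?)

-- The letter l changes the height by lift l − 1.
lift : Letter → ℕ
lift l = bit (α l) ℕ.+ bit (β l)

letter : Bool → Bool → Letter
letter true  true  = N
letter true  false = dE
letter false true  = E
letter false false = S

α-letter : ∀ a b → α (letter a b) ≡ a
α-letter true  true  = refl
α-letter true  false = refl
α-letter false true  = refl
α-letter false false = refl

β-letter : ∀ a b → β (letter a b) ≡ b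
β-letter true  true  = refl
β-letter true  false = refl
β-letter false true  = refl
β-letter false false = refl

letter-αβ : ∀ l → letter (α l) (β l) ≡ l
letter-αβ N  = refl
letter-αβ S  = refl
letter-αβ E  = refl
letter-αβ dE = refl

does-isSordE : ∀ l → does (l isSordE?) ≡ not (β l)
does-isSordE N  = refl
does-isSordE S  = refl
does-isSordE E  = refl
does-isSordE dE = refl

occurs? : ∀ l {n} (u : Vec Letter n) (i : Fin (suc n)) →
          Decidable (λ j → toℕ j < toℕ i × lookup u j ≡ l)
occurs? l u i j = (toℕ j ℕ.<? toℕ i) ×-dec (lookup u j ≟ᴸ l)

occurrences-zero : ∀ l {n} (u : Vec Letter n) → occurrencesBefore l u zero ≡ 0
occurrences-zero l {n} u = trans (countFin-sum (occurs? l u zero)) (sum-zero n)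
  where
  sum-zero : ∀ n → sumFin {n} (λ _ → 0) ≡ 0
  sum-zero zero    = refl
  sum-zero (suc n) = trans (sumFin-suc {n} (λ _ → 0)) (sum-zero n)

occurrences-∷ : ∀ l {n} k (u : Vec Letter n) i →
  occurrencesBefore l (k ∷ u) (suc i) ≡ bit (does (k ≟ᴸ l)) ℕ.+ occurrencesBefore l u i
occurrences-∷ l k u i = begin
  occurrencesBefore l (k ∷ u) (suc i)
    ≡⟨ countFin-sum (occurs? l (k ∷ u) (suc i)) ⟩
  sumFin (λ j → bit (does (occurs? l (k ∷ u) (suc i) j)))
    ≡⟨ sumFin-suc (λ j → bit (does (occurs? l (k ∷ u) (suc i) j))) ⟩
  bit (does (k ≟ᴸ l)) ℕ.+ sumFin (λ j → bit (does (occurs? l u i j)))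
    ≡⟨ cong (bit (does (k ≟ᴸ l)) ℕ.+_) (countFin-sum (occurs? l u i)) ⟨
  bit (does (k ≟ᴸ l)) ℕ.+ occurrencesBefore l u i ∎
  where open ≡-Reasoning

-- Counts unfold at the front of the word, whereas heights advance at position `i`; induction on the
-- word bridges the two, both sides losing the same first letter.
occurrences-suc : ∀ l {n} (u : Vec Letter n) i →
  occurrencesBefore l u (suc i) ≡ occurrencesBefore l u (inject₁ i) ℕ.+ bit (does (lookup u i ≟ᴸ l))
occurrences-suc l (k ∷ u) zero
  rewrite occurrences-∷ l k u zero | occurrences-zero l u | occurrences-zero l (k ∷ u) = ℕ.+-identityʳ _
occurrences-suc l (k ∷ u) (suc i)
  rewrite occurrences-∷ l k u (suc i) | occurrences-∷ l k u (inject₁ i) | occurrences-suc l u i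
  = sym (ℕ.+-assoc (bit (does (k ≟ᴸ l))) _ _)

height-zero : ∀ {n} (u : Vec Letter n) → height u zero ≡ 0ℤ
height-zero u = cong₂ _⊖_ (occurrences-zero N u) (occurrences-zero S u)

height-suc : ∀ {n} (u : Vec Letter n) i →
  height u (suc i) ℤ.+ 1ℤ ≡ height u (inject₁ i) ℤ.+ + lift (lookup u i)
height-suc u i = trans
  (cong (ℤ._+ 1ℤ) (cong₂ _⊖_ (occurrences-suc N u i) (occurrences-suc S u i)))
  (step (lookup u i) (occurrencesBefore N u (inject₁ i)) (occurrencesBefore S u (inject₁ i)))
  where
  up : ∀ p q → p ℤ.+ 1ℤ ℤ.- (q ℤ.+ 0ℤ) ℤ.+ 1ℤ ≡ p ℤ.- q ℤ.+ (1ℤ ℤ.+ 1ℤ)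
  up = solve-∀
  down : ∀ p q → p ℤ.+ 0ℤ ℤ.- (q ℤ.+ 1ℤ) ℤ.+ 1ℤ ≡ p ℤ.- q ℤ.+ 0ℤ
  down = solve-∀
  level : ∀ p q → p ℤ.+ 0ℤ ℤ.- (q ℤ.+ 0ℤ) ℤ.+ 1ℤ ≡ p ℤ.- q ℤ.+ 1ℤ
  level = solve-∀
  step : ∀ l p q → (p ℕ.+ bit (does (l ≟ᴸ N))) ⊖ (q ℕ.+ bit (does (l ≟ᴸ S))) ℤ.+ 1ℤ
                 ≡ p ⊖ q ℤ.+ + lift l
  -- `_⊖_` is traded for integer subtraction, which the ring solver can handle.
  step l p q rewrite sym (ℤ.m-n≡m⊖n (p ℕ.+ bit (does (l ≟ᴸ N))) (q ℕ.+ bit (does (l ≟ᴸ S))))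
                   | sym (ℤ.m-n≡m⊖n p q) with l
  ... | N  = up (+ p) (+ q)
  ... | S  = down (+ p) (+ q)
  ... | E  = level (+ p) (+ q)
  ... | dE = level (+ p) (+ q)

-- The heights h of a history W, with natural values and no subtraction; the
-- field end says that the final height is 0.
record Profile {m} (W : Labelled (suc m)) (h : Fin (suc m) → ℕ) : Set where
  field
    start   : h zero ≡ 0
    step    : ∀ j → suc (h (suc j)) ≡ h (inject₁ j) ℕ.+ lift (lookup (proj₁ W) (inject₁ j))
    end     : h (fromℕ m) ℕ.+ lift (lookup (proj₁ W) (fromℕ m)) ≡ 1
    label≤  : ∀ i → lookup (proj₂ W) i ≤ h i
    label>0 : ∀ i → β (lookup (proj₁ W) i) ≡ false → 0 < lookup (proj₂ W) i

module _ {m : ℕ} {W : Labelled (suc m)} where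

  private
    u = proj₁ W
    c = proj₂ W

  height-profile : ∀ {h} → Profile W h → ∀ i → height u (inject₁ i) ≡ + h i
  height-profile {h} P = <-weakInduction _ base next
    where
    open Profile P
    base : height u zero ≡ + h zero
    base = trans (height-zero u) (cong +_ (sym start))
    next : ∀ j → height u (inject₁ (inject₁ j)) ≡ + h (inject₁ j) →
           height u (suc (inject₁ j)) ≡ + h (suc j)
    next j ih = ∙-cancelʳ 1ℤ _ _ (begin
      height u (suc (inject₁ j)) ℤ.+ 1ℤ
        ≡⟨ height-suc u (inject₁ j) ⟩
      height u (inject₁ (inject₁ j)) ℤ.+ + lift (lookup u (inject₁ j))
        ≡⟨ cong (ℤ._+ + lift (lookup u (inject₁ j))) ih ⟩
      + (h (inject₁ j) ℕ.+ lift (lookup u (inject₁ j)))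
        ≡⟨ cong +_ (step j) ⟨
      + suc (h (suc j))
        ≡⟨ cong +_ (ℕ.+-comm 1 (h (suc j))) ⟩
      + h (suc j) ℤ.+ 1ℤ ∎)
      where open ≡-Reasoning

  profile⇒history : ∀ {h} → Profile W h → IsHistory W
  profile⇒history {h} P = (nonneg , final) , label
    where
    open Profile P
    heights = height-profile P

    final : height u (fromℕ (suc m)) ≡ 0ℤ
    final = ∙-cancelʳ 1ℤ _ _ (begin
      height u (suc (fromℕ m)) ℤ.+ 1ℤ
        ≡⟨ height-suc u (fromℕ m) ⟩
      height u (inject₁ (fromℕ m)) ℤ.+ + lift (lookup u (fromℕ m))
        ≡⟨ cong (ℤ._+ + lift (lookup u (fromℕ m))) (heights (fromℕ m)) ⟩
      + (h (fromℕ m) ℕ.+ lift (lookup u (fromℕ m)))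
        ≡⟨ cong +_ end ⟩
      1ℤ ∎)
      where open ≡-Reasoning

    nonneg : ∀ i → 0ℤ ℤ.≤ height u i
    nonneg i with view i
    ... | ‵fromℕ     = ℤ.≤-reflexive (sym final)
    ... | ‵inject₁ j = ℤ.≤-trans (ℤ.+≤+ z≤n) (ℤ.≤-reflexive (sym (heights j)))

    label : ∀ i → LabelOK (lookup u i) (height u (inject₁ i)) (lookup c i)
    label i rewrite heights i with lookup u i | label>0 i
    ... | N  | _   = inj₁ (inj₁ refl , ℤ.+≤+ (label≤ i))
    ... | E  | _   = inj₁ (inj₂ refl , ℤ.+≤+ (label≤ i))
    ... | S  | 0<c = inj₂ (inj₁ refl , 0<c refl , ℤ.+≤+ (label≤ i))
    ... | dE | 0<c = inj₂ (inj₂ refl , 0<c refl , ℤ.+≤+ (label≤ i))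

  history⇒profile : IsHistory W → Profile W (λ i → ∣ height u (inject₁ i) ∣)
  history⇒profile ((nonneg , final) , label) = record
    { start   = cong ∣_∣ (height-zero u)
    ; step    = λ j → ℤ.+-injective (trans (cong +_ (ℕ.+-comm 1 _)) (increment (inject₁ j)))
    ; end     = ℤ.+-injective (trans (sym (increment (fromℕ m))) (cong (λ x → + ∣ x ∣ ℤ.+ 1ℤ) final))
    ; label≤  = label≤
    ; label>0 = label>0
    }
    where
    +∣height∣ : ∀ i → + ∣ height u i ∣ ≡ height u i
    +∣height∣ i = ℤ.0≤i⇒+∣i∣≡i (nonneg i)

    increment : ∀ i → + ∣ height u (suc i) ∣ ℤ.+ 1ℤ ≡ + (∣ height u (inject₁ i) ∣ ℕ.+ lift (lookup u i))
    increment i = trans (cong (ℤ._+ 1ℤ) (+∣height∣ (suc i)))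
      (trans (height-suc u i) (cong (ℤ._+ + lift (lookup u i)) (sym (+∣height∣ (inject₁ i)))))

    label≤ : ∀ i → lookup c i ≤ ∣ height u (inject₁ i) ∣
    label≤ i with label i
    ... | inj₁ (_ , q)     = ℤ.drop‿+≤+ (ℤ.≤-trans q (ℤ.≤-reflexive (sym (+∣height∣ (inject₁ i)))))
    ... | inj₂ (_ , _ , q) = ℤ.drop‿+≤+ (ℤ.≤-trans q (ℤ.≤-reflexive (sym (+∣height∣ (inject₁ i)))))

    label>0 : ∀ i → β (lookup u i) ≡ false → 0 < lookup c i
    label>0 i β≡false with label i
    ... | inj₁ (p , _)     = contradiction (trans (sym (dec-true (lookup u i isNorE?) p)) β≡false) λ ()
    ... | inj₂ (_ , q , _) = q

  -- The position of the last zero label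

  zeroLabels : List (Fin (suc m))
  zeroLabels = filter (λ i → lookup c i ℕ.≟ 0) (allFin (suc m))

  ≤-cs : ∀ i → lookup c i ≡ 0 → suc (toℕ i) ≤ cs W
  ≤-cs i c≡0 = All.lookup (xs≤max 0 (map (suc ∘ toℕ) zeroLabels))
    (∈-map⁺ (suc ∘ toℕ) (∈-filter⁺ (λ i → lookup c i ℕ.≟ 0) (∈-allFin i) c≡0))

  ∃-cs : ∀ i → lookup c i ≡ 0 → ∃[ p ] cs W ≡ suc (toℕ p) × lookup c p ≡ 0
  ∃-cs i c≡0 with argmax-sel id 0 (map (suc ∘ toℕ) zeroLabels)
  -- The default value 0 of the maximum is excluded: the zero label at `i` forces `cs W` to be at
  -- least 1.
  ... | inj₁ cs≡0 = contradiction (subst (suc (toℕ i) ≤_) cs≡0 (≤-cs i c≡0)) λ ()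
  ... | inj₂ cs∈  with p , p∈ , cs≡ ← ∈-map⁻ (suc ∘ toℕ) cs∈ =
    p , cs≡ , proj₂ (∈-filter⁻ (λ i → lookup c i ℕ.≟ 0) {xs = allFin (suc m)} p∈)

  cs-unique : ∀ p → lookup c p ≡ 0 → (∀ i → lookup c i ≡ 0 → toℕ i ≤ toℕ p) → cs W ≡ suc (toℕ p)
  cs-unique p c≡0 last = ℕ.≤-antisym (max≤v⁺ z≤n (All.tabulate bound)) (≤-cs p c≡0)
    where
    bound : ∀ {k} → k ∈ map (suc ∘ toℕ) zeroLabels → k ≤ suc (toℕ p)
    bound k∈ with i , i∈ , refl ← ∈-map⁻ (suc ∘ toℕ) k∈ =
      s≤s (last i (proj₂ (∈-filter⁻ (λ i → lookup c i ℕ.≟ 0) {xs = allFin (suc m)} i∈)))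

-- The mirror involution

opposite-fromℕ : ∀ n → opposite (fromℕ n) ≡ zero
opposite-fromℕ n = Fin.opposite-involutive zero

-- `opposite (suc i)` computes to `inject₁ (opposite i)`; involutivity turns this equation around.
opposite-inject₁ : ∀ {n} (i : Fin n) → opposite (inject₁ i) ≡ suc (opposite i)
opposite-inject₁ i = trans (cong (opposite ∘ inject₁) (sym (Fin.opposite-involutive i)))
                           (Fin.opposite-involutive (suc (opposite i)))

opposite-< : ∀ {n} {i j : Fin n} → toℕ i < toℕ j → toℕ (opposite j) < toℕ (opposite i)
opposite-< {i = i} {j} i<j rewrite Fin.opposite-prop i | Fin.opposite-prop j =
  ℕ.∸-monoʳ-< (s≤s i<j) (Fin.toℕ<n j)

opposite-<⁻ : ∀ {n} {i j : Fin n} → toℕ (opposite j) < toℕ (opposite i) → toℕ i < toℕ j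
opposite-<⁻ {i = i} {j} p =
  subst₂ (λ i j → toℕ i < toℕ j) (Fin.opposite-involutive i) (Fin.opposite-involutive j) (opposite-< p)

module _ {m : ℕ} (W : Labelled (suc m)) where

  private
    u = proj₁ W
    c = proj₂ W

  -- Opaque, since unfolding the maximum in cs makes every goal huge.
  opaque
    isBefore isAt isAfter : Fin (suc m) → Bool
    isBefore k = does (suc (toℕ k) ℕ.<? cs W)
    isAt     k = does (suc (toℕ k) ℕ.≟ cs W)
    isAfter  k = does (cs W ℕ.<? suc (toℕ k))

    isBefore-def : ∀ k → isBefore k ≡ does (suc (toℕ k) ℕ.<? cs W)
    isBefore-def k = refl

    isAt-def : ∀ k → isAt k ≡ does (suc (toℕ k) ℕ.≟ cs W)
    isAt-def k = refl

    isAfter-def : ∀ k → isAfter k ≡ does (cs W ℕ.<? suc (toℕ k))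
    isAfter-def k = refl

  -- The correction bₖ - [k ≥ p] split into its positive and negative parts: it is bₖ before p, zero
  -- at p because bₚ = 1, and -(1 - bₖ) after p.
  gain loss : Fin (suc m) → ℕ
  gain k = bit (isBefore k ∧ β (lookup u k))
  loss k = bit (isAfter k ∧ not (β (lookup u k)))

  -- Applied only to f ≥ c, where loss ≤ f and the subtraction is not truncated.
  shift : (Fin (suc m) → ℕ) → Fin (suc m) → ℕ
  shift f k = f k ℕ.+ gain k ℕ.∸ loss k

  -- The bits α are reversed with an offset of one: in a history the last one is
  -- always false, and nde does not count it.
  α′ β′ : Fin (suc m) → Bool
  α′ zero    = false
  α′ (suc l) = not (α (lookup u (inject₁ l)))
  β′ k = isAt k ∨ not (β (lookup u k))

  mirror : Labelled (suc m)
  mirror = tabulate ((λ k → letter (α′ k) (β′ k)) ∘ opposite) , tabulate (shift (lookup c) ∘ opposite)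

  -- Facts about the mirrored word are stated at `opposite k`, so that they refer to the data of `W`
  -- at `k` itself.
  α-mirror : ∀ k → α (lookup (proj₁ mirror) (opposite k)) ≡ α′ k
  α-mirror k = trans (cong α (Vec.lookup∘tabulate ((λ k → letter (α′ k) (β′ k)) ∘ opposite) (opposite k)))
    (trans (α-letter _ (β′ (opposite (opposite k)))) (cong α′ (Fin.opposite-involutive k)))

  β-mirror : ∀ k → β (lookup (proj₁ mirror) (opposite k)) ≡ β′ k
  β-mirror k = trans (cong β (Vec.lookup∘tabulate ((λ k → letter (α′ k) (β′ k)) ∘ opposite) (opposite k)))
    (trans (β-letter (α′ (opposite (opposite k))) _) (cong β′ (Fin.opposite-involutive k)))

  label-mirror : ∀ k → lookup (proj₂ mirror) (opposite k) ≡ shift (lookup c) k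
  label-mirror k = trans (Vec.lookup∘tabulate (shift (lookup c) ∘ opposite) (opposite k))
    (cong (shift (lookup c)) (Fin.opposite-involutive k))

-- Statistics as Boolean conditions on positions

module _ {m : ℕ} (W : Labelled (suc m)) where

  -- These deciders repeat the ones inside the statistics, so that `countFin` applied to them is
  -- definitionally the statistic.
  neb? : Decidable (λ i → suc (toℕ i) < cs W × lookup (proj₁ W) i isNorE)
  neb? i = (suc (toℕ i) ℕ.<? cs W) ×-dec (lookup (proj₁ W) i isNorE?)

  nea? : Decidable (λ i → cs W < suc (toℕ i) × lookup (proj₁ W) i isNorE)
  nea? i = (cs W ℕ.<? suc (toℕ i)) ×-dec (lookup (proj₁ W) i isNorE?)

  sdeb? : Decidable (λ i → suc (toℕ i) < cs W × lookup (proj₁ W) i isSordE)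
  sdeb? i = (suc (toℕ i) ℕ.<? cs W) ×-dec (lookup (proj₁ W) i isSordE?)

  sdea? : Decidable (λ i → cs W < suc (toℕ i) × lookup (proj₁ W) i isSordE)
  sdea? i = (cs W ℕ.<? suc (toℕ i)) ×-dec (lookup (proj₁ W) i isSordE?)

  does-neb? : ∀ k → does (neb? k) ≡ isBefore W k ∧ β (lookup (proj₁ W) k)
  does-neb? k = cong (_∧ β (lookup (proj₁ W) k)) (sym (isBefore-def W k))

  does-nea? : ∀ k → does (nea? k) ≡ isAfter W k ∧ β (lookup (proj₁ W) k)
  does-nea? k = cong (_∧ β (lookup (proj₁ W) k)) (sym (isAfter-def W k))

  does-sdeb? : ∀ k → does (sdeb? k) ≡ isBefore W k ∧ not (β (lookup (proj₁ W) k))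
  does-sdeb? k = cong₂ _∧_ (sym (isBefore-def W k)) (does-isSordE (lookup (proj₁ W) k))

  does-sdea? : ∀ k → does (sdea? k) ≡ isAfter W k ∧ not (β (lookup (proj₁ W) k))
  does-sdea? k = cong₂ _∧_ (sym (isAfter-def W k)) (does-isSordE (lookup (proj₁ W) k))

  Ascent : Letter → ℕ → ℕ → Set
  Ascent l i j = (l isNorE × i < j) ⊎ (l isSordE × i ≤ j)

  asc? : Decidable (λ i → Ascent (lookup (proj₁ W) (inject₁ i))
                                (lookup (proj₂ W) (inject₁ i)) (lookup (proj₂ W) (suc i)))
  asc? i = ((lookup (proj₁ W) (inject₁ i) isNorE?)
              ×-dec (lookup (proj₂ W) (inject₁ i) ℕ.<? lookup (proj₂ W) (suc i)))
     ⊎-dec ((lookup (proj₁ W) (inject₁ i) isSordE?)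
              ×-dec (lookup (proj₂ W) (inject₁ i) ℕ.≤? lookup (proj₂ W) (suc i)))

  threshold : Fin m → ℕ
  threshold i = lookup (proj₂ W) (inject₁ i) ℕ.+ bit (β (lookup (proj₁ W) (inject₁ i)))

  -- A strict inequality is a weak one with a successor on the left, and the β bit supplies that
  -- successor exactly for `N` and `E`.
  does-asc? : ∀ i → does (asc? i) ≡ does (threshold i ℕ.≤? lookup (proj₂ W) (suc i))
  does-asc? i with lookup (proj₁ W) (inject₁ i)
  ... | N  rewrite ℕ.+-comm (lookup (proj₂ W) (inject₁ i)) 1 = Bool.∨-identityʳ _
  ... | E  rewrite ℕ.+-comm (lookup (proj₂ W) (inject₁ i)) 1 = Bool.∨-identityʳ _
  ... | S  rewrite ℕ.+-identityʳ (lookup (proj₂ W) (inject₁ i)) = refl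
  ... | dE rewrite ℕ.+-identityʳ (lookup (proj₂ W) (inject₁ i)) = refl

-- The mirror image of one history with last zero label at `p`

module Mirror {m : ℕ} {W : Labelled (suc m)} {h : Fin (suc m) → ℕ} {p : Fin (suc m)}
              (profile : Profile W h) (cs≡ : cs W ≡ suc (toℕ p)) (cₚ≡0 : lookup (proj₂ W) p ≡ 0) where

  private
    u = proj₁ W
    c = proj₂ W
    W′ = mirror W
    u′ = proj₁ W′
    c′ = proj₂ W′
    M = cs W

  open Profile profile

  data Place (k : Fin (suc m)) : Set where
    before : toℕ k < toℕ p →
             isBefore W k ≡ true → isAt W k ≡ false → isAfter W k ≡ false → Place k
    at     : k ≡ p → β (lookup u k) ≡ true →
             isBefore W k ≡ false → isAt W k ≡ true → isAfter W k ≡ false → Place k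
    after  : toℕ p < toℕ k → 0 < lookup c k →
             isBefore W k ≡ false → isAt W k ≡ false → isAfter W k ≡ true → Place k

  -- At `p` the label is 0, which `S` and `dE` forbid, so the letter is `N` or `E`; beyond `p` a
  -- zero label would contradict the maximality of `cs W`.
  place : ∀ k → Place k
  place k with ℕ.<-cmp (suc (toℕ k)) M
  ... | tri< k<M k≢M k≯M = before (ℕ.s<s⁻¹ (subst (suc (toℕ k) <_) cs≡ k<M))
    (trans (isBefore-def W k) (dec-true (_ ℕ.<? _) k<M))
    (trans (isAt-def W k) (dec-false (_ ℕ.≟ _) k≢M))
    (trans (isAfter-def W k) (dec-false (_ ℕ.<? _) k≯M))
  ... | tri≈ k≮M k≡M k≯M = at k≡p βₖ
    (trans (isBefore-def W k) (dec-false (_ ℕ.<? _) k≮M))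
    (trans (isAt-def W k) (dec-true (_ ℕ.≟ _) k≡M))
    (trans (isAfter-def W k) (dec-false (_ ℕ.<? _) k≯M))
    where
    k≡p : k ≡ p
    k≡p = Fin.toℕ-injective (ℕ.suc-injective (trans k≡M cs≡))
    βₖ : β (lookup u k) ≡ true
    βₖ with β (lookup u k) in eq
    ... | true  = refl
    ... | false = contradiction (subst (0 <_) (trans (cong (lookup c) k≡p) cₚ≡0) (label>0 k eq)) λ ()
  ... | tri> k≮M k≢M k>M = after (ℕ.s<s⁻¹ (subst (_< suc (toℕ k)) cs≡ k>M))
    (ℕ.n≢0⇒n>0 (λ cₖ≡0 → ℕ.<⇒≱ k>M (≤-cs {W = W} k cₖ≡0)))
    (trans (isBefore-def W k) (dec-false (_ ℕ.<? _) k≮M))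
    (trans (isAt-def W k) (dec-false (_ ℕ.≟ _) k≢M))
    (trans (isAfter-def W k) (dec-true (_ ℕ.<? _) k>M))

  -- A loss occurs only at `S` or `dE`, where labels are positive.
  loss≤label : ∀ k → loss W k ≤ lookup c k
  loss≤label k with isAfter W k | β (lookup u k) in eq
  ... | false | _     = z≤n
  ... | true  | true  = z≤n
  ... | true  | false = label>0 k eq

  shift-spec : ∀ {f} → (∀ k → lookup c k ≤ f k) → ∀ k → shift W f k ℕ.+ loss W k ≡ f k ℕ.+ gain W k
  shift-spec c≤f k = ℕ.m∸n+n≡m (ℕ.≤-trans (loss≤label k) (ℕ.≤-trans (c≤f k) (ℕ.m≤m+n _ _)))

  -- The indicator [k ≥ p].
  fromCs : Fin (suc m) → ℕ
  fromCs k = bit (not (isBefore W k))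

  -- This is gain - loss = bₖ - [k ≥ p], arranged without subtraction.
  gain+fromCs : ∀ k → gain W k ℕ.+ fromCs k ≡ bit (β (lookup u k)) ℕ.+ loss W k
  gain+fromCs k with place k
  ... | before _ b _ a rewrite b | a = refl
  ... | at _ β≡ b _ a rewrite b | a | β≡ = refl
  ... | after _ _ b _ a rewrite b | a with β (lookup u k)
  ...   | true  = refl
  ...   | false = refl

  -- The two bits are complementary except at `p`, where both are 1.
  β′+β : ∀ k → bit (β′ W k) ℕ.+ bit (β (lookup u k)) ≡ suc (bit (isAt W k))
  β′+β k with place k
  ... | at _ β≡ _ e _ rewrite e | β≡ = refl
  ... | before _ _ e _ rewrite e with β (lookup u k)
  ...   | true  = refl
  ...   | false = refl
  β′+β k | after _ _ _ e _ rewrite e with β (lookup u k)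
  ...   | true  = refl
  ...   | false = refl

  fromCs-zero : fromCs zero ≡ bit (isAt W zero)
  fromCs-zero with place zero
  ... | before _ b e _ rewrite b | e = refl
  ... | at _ _ b e _ rewrite b | e = refl
  ... | after () _ _ _ _

  fromCs-suc : ∀ l → fromCs (suc l) ≡ fromCs (inject₁ l) ℕ.+ bit (isAt W (suc l))
  fromCs-suc l
    rewrite isBefore-def W (suc l) | isBefore-def W (inject₁ l) | isAt-def W (suc l)
          | Fin.toℕ-inject₁ l = ≮-suc (suc (toℕ l)) M
    where
    ≮-suc : ∀ i j → bit (not (does (suc i ℕ.<? j)))
                  ≡ bit (not (does (i ℕ.<? j))) ℕ.+ bit (does (suc i ℕ.≟ j))
    ≮-suc i j with ℕ.<-cmp (suc i) j
    ... | tri< lt ≢ _ rewrite dec-true (suc i ℕ.<? j) lt | dec-false (suc i ℕ.≟ j) ≢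
                            | dec-true (i ℕ.<? j) (ℕ.<-trans (ℕ.n<1+n i) lt) = refl
    ... | tri≈ ≮ ≡ _ rewrite dec-false (suc i ℕ.<? j) ≮ | dec-true (suc i ℕ.≟ j) ≡
                           | dec-true (i ℕ.<? j) (ℕ.≤-reflexive ≡) = refl
    ... | tri> ≮ ≢ gt rewrite dec-false (suc i ℕ.<? j) ≮ | dec-false (suc i ℕ.≟ j) ≢
                            | dec-false (i ℕ.<? j) (ℕ.≤⇒≯ (ℕ.s≤s⁻¹ gt)) = refl

  module _ {f : Fin (suc m) → ℕ} (c≤f : ∀ k → lookup c k ≤ f k) where

    -- The formula f′ = fₖ + bₖ - [k ≥ p] with the subtraction moved across; `f` stands for the
    -- heights and for the labels alike.
    shift+fromCs : ∀ k → shift W f k ℕ.+ fromCs k ≡ f k ℕ.+ bit (β (lookup u k))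
    shift+fromCs k = ℕ.+-cancelʳ-≡ (gain W k ℕ.+ loss W k) _ _ (begin
      shift W f k ℕ.+ fromCs k ℕ.+ (gain W k ℕ.+ loss W k)
        ≡⟨ rearrange₁ (shift W f k) (fromCs k) (gain W k) (loss W k) ⟩
      shift W f k ℕ.+ loss W k ℕ.+ (gain W k ℕ.+ fromCs k)
        ≡⟨ cong₂ ℕ._+_ (shift-spec c≤f k) (gain+fromCs k) ⟩
      f k ℕ.+ gain W k ℕ.+ (bit (β (lookup u k)) ℕ.+ loss W k)
        ≡⟨ rearrange₂ (f k) (gain W k) (bit (β (lookup u k))) (loss W k) ⟩
      f k ℕ.+ bit (β (lookup u k)) ℕ.+ (gain W k ℕ.+ loss W k) ∎)
      where
      open ≡-Reasoning
      rearrange₁ : ∀ a b c d → a ℕ.+ b ℕ.+ (c ℕ.+ d) ≡ a ℕ.+ d ℕ.+ (c ℕ.+ b)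
      rearrange₁ = ℕ.solve-∀
      rearrange₂ : ∀ a b c d → a ℕ.+ b ℕ.+ (c ℕ.+ d) ≡ a ℕ.+ c ℕ.+ (b ℕ.+ d)
      rearrange₂ = ℕ.solve-∀

    shift+β′+fromCs : ∀ k → shift W f k ℕ.+ bit (β′ W k) ℕ.+ fromCs k ≡ suc (f k) ℕ.+ bit (isAt W k)
    shift+β′+fromCs k = ℕ.+-cancelʳ-≡ (bit (β (lookup u k))) _ _ (begin
      shift W f k ℕ.+ bit (β′ W k) ℕ.+ fromCs k ℕ.+ bit (β (lookup u k))
        ≡⟨ rearrange₁ (shift W f k) (bit (β′ W k)) (fromCs k) (bit (β (lookup u k))) ⟩
      shift W f k ℕ.+ fromCs k ℕ.+ (bit (β′ W k) ℕ.+ bit (β (lookup u k)))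
        ≡⟨ cong₂ ℕ._+_ (shift+fromCs k) (β′+β k) ⟩
      f k ℕ.+ bit (β (lookup u k)) ℕ.+ suc (bit (isAt W k))
        ≡⟨ rearrange₂ (f k) (bit (β (lookup u k))) (bit (isAt W k)) ⟩
      suc (f k) ℕ.+ bit (isAt W k) ℕ.+ bit (β (lookup u k)) ∎)
      where
      open ≡-Reasoning
      rearrange₁ : ∀ a b c d → a ℕ.+ b ℕ.+ c ℕ.+ d ≡ a ℕ.+ c ℕ.+ (b ℕ.+ d)
      rearrange₁ = ℕ.solve-∀
      rearrange₂ : ∀ a b c → a ℕ.+ b ℕ.+ (1 ℕ.+ c) ≡ 1 ℕ.+ a ℕ.+ c ℕ.+ b
      rearrange₂ = ℕ.solve-∀

    -- Passing from `inject₁ l` to `suc l`, the indicator [k ≥ p] grows precisely by the `isAt` bit,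
    -- which therefore cancels. With the heights as `f` this drives the height recursion of the
    -- mirror, with the labels as `f` the reversal of ascents.
    shift+β′-suc : ∀ l → shift W f (suc l) ℕ.+ bit (β′ W (suc l)) ℕ.+ fromCs (inject₁ l) ≡ suc (f (suc l))
    shift+β′-suc l = ℕ.+-cancelʳ-≡ (bit (isAt W (suc l))) _ _ (trans
      (trans (ℕ.+-assoc (shift W f (suc l) ℕ.+ bit (β′ W (suc l))) (fromCs (inject₁ l)) (bit (isAt W (suc l))))
             (cong (shift W f (suc l) ℕ.+ bit (β′ W (suc l)) ℕ.+_) (sym (fromCs-suc l))))
      (shift+β′+fromCs (suc l)))

  -- The label at `p` stays 0. Before `p` every shifted label is positive: `N` and `E` gain 1, while
  -- `S` and `dE` keep a positive label. Under reversal these are the positions after `opposite p`.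
  cs-mirror≡ : cs W′ ≡ suc (toℕ (opposite p))
  cs-mirror≡ = cs-unique {W = W′} (opposite p) zeroAt lastZero
    where
    zeroAt : lookup c′ (opposite p) ≡ 0
    zeroAt with place p
    ... | at _ _ b _ a = trans (label-mirror W p) z
      where
      z : shift W (lookup c) p ≡ 0
      z rewrite b | a | cₚ≡0 = refl
    ... | before p<p _ _ _ = contradiction p<p (ℕ.<-irrefl refl)
    ... | after p<p _ _ _ _ = contradiction p<p (ℕ.<-irrefl refl)

    positive : ∀ {k} → toℕ k < toℕ p → 0 < shift W (lookup c) k
    positive {k} k<p with place k
    ... | at refl _ _ _ _ = contradiction k<p (ℕ.<-irrefl refl)
    ... | after p<k _ _ _ _ = contradiction k<p (ℕ.<-asym p<k)
    ... | before _ b _ a rewrite b | a with β (lookup u k) in eq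
    ...   | true  = ℕ.m≤n+m 1 (lookup c k)
    ...   | false = ℕ.≤-trans (label>0 k eq) (ℕ.m≤m+n _ 0)

    lastZero : ∀ i → lookup c′ i ≡ 0 → toℕ i ≤ toℕ (opposite p)
    lastZero i cᵢ≡0 = ℕ.≮⇒≥ λ p′<i →
      ℕ.<-irrefl (sym (trans (sym (label-mirror W (opposite i)))
                             (trans (cong (lookup c′) (Fin.opposite-involutive i)) cᵢ≡0)))
        (positive (subst (λ q → toℕ (opposite i) < toℕ q) (Fin.opposite-involutive p) (opposite-< p′<i)))

  isBefore-mirror : ∀ k → isBefore W′ (opposite k) ≡ isAfter W k
  isBefore-mirror k rewrite isBefore-def W′ (opposite k) | isAfter-def W k | cs-mirror≡ | cs≡ =
    does-⇔ (mk⇔ (λ q → s≤s (opposite-<⁻ (ℕ.s<s⁻¹ q))) (λ q → s≤s (opposite-< (ℕ.s<s⁻¹ q))))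
    (suc (toℕ (opposite k)) ℕ.<? suc (toℕ (opposite p))) (suc (toℕ p) ℕ.<? suc (toℕ k))

  isAfter-mirror : ∀ k → isAfter W′ (opposite k) ≡ isBefore W k
  isAfter-mirror k rewrite isAfter-def W′ (opposite k) | isBefore-def W k | cs-mirror≡ | cs≡ =
    does-⇔ (mk⇔ (λ q → s≤s (opposite-<⁻ (ℕ.s<s⁻¹ q))) (λ q → s≤s (opposite-< (ℕ.s<s⁻¹ q))))
    (suc (toℕ (opposite p)) ℕ.<? suc (toℕ (opposite k))) (suc (toℕ k) ℕ.<? suc (toℕ p))

  isAt-mirror : ∀ k → isAt W′ (opposite k) ≡ isAt W k
  isAt-mirror k rewrite isAt-def W′ (opposite k) | isAt-def W k | cs-mirror≡ | cs≡ = does-⇔ (mk⇔ to from)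
    (suc (toℕ (opposite k)) ℕ.≟ suc (toℕ (opposite p))) (suc (toℕ k) ℕ.≟ suc (toℕ p))
    where
    to : suc (toℕ (opposite k)) ≡ suc (toℕ (opposite p)) → suc (toℕ k) ≡ suc (toℕ p)
    to q = cong (suc ∘ toℕ) (subst₂ _≡_ (Fin.opposite-involutive k) (Fin.opposite-involutive p)
      (cong opposite (Fin.toℕ-injective (ℕ.suc-injective q))))
    from : suc (toℕ k) ≡ suc (toℕ p) → suc (toℕ (opposite k)) ≡ suc (toℕ (opposite p))
    from q = cong (suc ∘ toℕ ∘ opposite) (Fin.toℕ-injective (ℕ.suc-injective q))

  -- Reversal exchanges before and after, and β is negated away from `p`; so gains and losses trade
  -- places, and a second shift undoes the first.
  gain-mirror : ∀ k → gain W′ (opposite k) ≡ loss W k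
  gain-mirror k rewrite isBefore-mirror k | β-mirror W k with place k
  ... | before _ _ _ a rewrite a = refl
  ... | at _ _ _ _ a rewrite a = refl
  ... | after _ _ _ e _ rewrite e = refl

  loss-mirror : ∀ k → loss W′ (opposite k) ≡ gain W k
  loss-mirror k rewrite isAfter-mirror k | β-mirror W k with place k
  ... | at _ _ b _ _ rewrite b = refl
  ... | after _ _ b _ _ rewrite b = refl
  ... | before _ _ e _ rewrite e = cong (λ b → bit (isBefore W k ∧ b)) (Bool.not-involutive (β (lookup u k)))

  -- `end` leaves no room for `N`, whose lift is 2. For `dE` it forces height 0, which is
  -- incompatible with a positive label.
  α-last : α (lookup u (fromℕ m)) ≡ false
  α-last with lookup u (fromℕ m) | end | label>0 (fromℕ m)
  ... | S  | _ | _ = refl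
  ... | E  | _ | _ = refl
  ... | N  | e | _ = contradiction (trans (ℕ.+-comm 2 _) e) λ ()
  ... | dE | e | 0<c = contradiction (ℕ.≤-trans (0<c refl) (label≤ (fromℕ m)))
    (ℕ.≤⇒≯ (ℕ.≤-reflexive (ℕ.suc-injective (trans (ℕ.+-comm 1 _) e))))

  mirror-involutive : mirror W′ ≡ W
  mirror-involutive = cong₂ _,_
    (trans (Vec.tabulate-cong letters≡) (Vec.tabulate∘lookup u))
    (trans (Vec.tabulate-cong labels≡) (Vec.tabulate∘lookup c))
    where
    α≡ : ∀ k → α′ W′ (opposite k) ≡ α (lookup u k)
    α≡ k with view k
    -- The last α bit does not survive in `mirror W`; it is recovered because it must be `false`.
    ... | ‵fromℕ rewrite opposite-fromℕ m = sym α-last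
    ... | ‵inject₁ l rewrite opposite-inject₁ l =
      trans (cong not (α-mirror W (suc l))) (Bool.not-involutive _)

    β≡ : ∀ k → β′ W′ (opposite k) ≡ β (lookup u k)
    β≡ k rewrite isAt-mirror k | β-mirror W k with place k
    ... | at _ β≡true _ e _ rewrite e = sym β≡true
    ... | before _ _ e _ rewrite e = Bool.not-involutive _
    ... | after _ _ _ e _ rewrite e = Bool.not-involutive _

    letters≡ : ∀ k → letter (α′ W′ (opposite k)) (β′ W′ (opposite k)) ≡ lookup u k
    letters≡ k = trans (cong₂ letter (α≡ k) (β≡ k)) (letter-αβ (lookup u k))

    labels≡ : ∀ k → shift W′ (lookup c′) (opposite k) ≡ lookup c k
    labels≡ k = begin
      lookup c′ (opposite k) ℕ.+ gain W′ (opposite k) ℕ.∸ loss W′ (opposite k)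
        ≡⟨ cong₂ ℕ._∸_ (cong₂ ℕ._+_ (label-mirror W k) (gain-mirror k)) (loss-mirror k) ⟩
      shift W (lookup c) k ℕ.+ loss W k ℕ.∸ gain W k
        ≡⟨ cong (ℕ._∸ gain W k) (shift-spec (λ _ → ℕ.≤-refl) k) ⟩
      lookup c k ℕ.+ gain W k ℕ.∸ gain W k
        ≡⟨ ℕ.m+n∸n≡m (lookup c k) (gain W k) ⟩
      lookup c k ∎
      where open ≡-Reasoning

  mirror-profile : Profile W′ (shift W h ∘ opposite)
  mirror-profile = record
    { start   = ℕ.+-cancelʳ-≡ 1 _ _ (trans (cong (shift W h (fromℕ m) ℕ.+_) (sym fromCs-last))
                  (trans (shift+fromCs label≤ (fromℕ m)) lastHeight))
    -- The claim is proved at `opposite l` for every `l`, which covers all positions since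
    -- `opposite` is an involution; the label conditions are handled likewise.
    ; step    = λ j → subst (λ j → suc (shift W h (opposite (suc j)))
                                ≡ shift W h (opposite (inject₁ j)) ℕ.+ lift (lookup u′ (inject₁ j)))
                            (Fin.opposite-involutive j) (step′ (opposite j))
    ; end     = end′
    ; label≤  = λ i → subst (λ i → lookup c′ i ≤ shift W h (opposite i))
                            (Fin.opposite-involutive i) (label≤′ (opposite i))
    ; label>0 = λ i → subst (λ i → β (lookup u′ i) ≡ false → 0 < lookup c′ i)
                            (Fin.opposite-involutive i) (label>0′ (opposite i))
    }
    where
    fromCs-last : fromCs (fromℕ m) ≡ 1
    fromCs-last = cong (bit ∘ not) (trans (isBefore-def W (fromℕ m)) (dec-false (suc (toℕ (fromℕ m)) ℕ.<? M)
      (ℕ.≤⇒≯ (subst₂ _≤_ (sym cs≡) (cong suc (sym (Fin.toℕ-fromℕ m))) (Fin.toℕ<n p)))))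

    -- As the last α bit is 0, `end` loses that summand. The remaining 1 is cancelled by [k ≥ p] = 1
    -- at the last position, so the mirror starts at height 0.
    lastHeight : h (fromℕ m) ℕ.+ bit (β (lookup u (fromℕ m))) ≡ 1
    lastHeight = trans (cong (λ a → h (fromℕ m) ℕ.+ (bit a ℕ.+ bit (β (lookup u (fromℕ m))))) (sym α-last)) end

    step′ : ∀ l → suc (shift W h (opposite (suc (opposite l))))
                ≡ shift W h (opposite (inject₁ (opposite l))) ℕ.+ lift (lookup u′ (inject₁ (opposite l)))
    step′ l rewrite Fin.opposite-involutive l | opposite-inject₁ (opposite l) | Fin.opposite-involutive l
                  | α-mirror W (suc l) | β-mirror W (suc l) =
      -- After `bit a` and `f` are added, both sides equal 2 + `h (suc l)`: the left by the height
      -- step of `W`, the right by `shift+β′-suc` and the complementarity of `a` and `not a`.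
      ℕ.+-cancelʳ-≡ (bit a) _ _ (ℕ.+-cancelʳ-≡ f _ _ (begin
        suc (shift W h (inject₁ l)) ℕ.+ bit a ℕ.+ f
          ≡⟨ rearrange₁ (shift W h (inject₁ l)) (bit a) f ⟩
        suc (shift W h (inject₁ l) ℕ.+ f ℕ.+ bit a)
          ≡⟨ cong (λ x → suc (x ℕ.+ bit a)) (shift+fromCs label≤ (inject₁ l)) ⟩
        suc (h (inject₁ l) ℕ.+ bit b ℕ.+ bit a)
          ≡⟨ cong suc (rearrange₂ (h (inject₁ l)) (bit b) (bit a)) ⟩
        suc (h (inject₁ l) ℕ.+ (bit a ℕ.+ bit b))
          ≡⟨ cong suc (step l) ⟨
        suc (suc (h (suc l)))
          ≡⟨ cong suc (shift+β′-suc label≤ l) ⟨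
        suc (shift W h (suc l) ℕ.+ bit (β′ W (suc l)) ℕ.+ f)
          ≡⟨ cong (ℕ._+ (shift W h (suc l) ℕ.+ bit (β′ W (suc l)) ℕ.+ f)) (bit-not a) ⟨
        bit (not a) ℕ.+ bit a ℕ.+ (shift W h (suc l) ℕ.+ bit (β′ W (suc l)) ℕ.+ f)
          ≡⟨ rearrange₃ (bit (not a)) (bit a) (shift W h (suc l)) (bit (β′ W (suc l))) f ⟩
        shift W h (suc l) ℕ.+ (bit (not a) ℕ.+ bit (β′ W (suc l))) ℕ.+ bit a ℕ.+ f ∎))
      where
      open ≡-Reasoning
      a = α (lookup u (inject₁ l))
      b = β (lookup u (inject₁ l))
      f = fromCs (inject₁ l)
      rearrange₁ : ∀ x y z → 1 ℕ.+ x ℕ.+ y ℕ.+ z ≡ 1 ℕ.+ (x ℕ.+ z ℕ.+ y)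
      rearrange₁ = ℕ.solve-∀
      rearrange₂ : ∀ x y z → x ℕ.+ y ℕ.+ z ≡ x ℕ.+ (z ℕ.+ y)
      rearrange₂ = ℕ.solve-∀
      rearrange₃ : ∀ x y z s t → x ℕ.+ y ℕ.+ (z ℕ.+ s ℕ.+ t) ≡ z ℕ.+ (x ℕ.+ s) ℕ.+ y ℕ.+ t
      rearrange₃ = ℕ.solve-∀

    end′ : shift W h (opposite (fromℕ m)) ℕ.+ lift (lookup u′ (fromℕ m)) ≡ 1
    -- `α′` is `false` at `zero`, so the lift reduces to the β′ bit; at `zero` the `isAt` bit agrees
    -- with `fromCs` and cancels.
    end′ rewrite opposite-fromℕ m | α-mirror W zero | β-mirror W zero =
      ℕ.+-cancelʳ-≡ (fromCs zero) _ _ (trans (shift+β′+fromCs label≤ zero)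
        (cong₂ (λ x y → suc x ℕ.+ y) start (sym fromCs-zero)))

    label≤′ : ∀ k → lookup c′ (opposite k) ≤ shift W h (opposite (opposite k))
    label≤′ k rewrite label-mirror W k | Fin.opposite-involutive k =
      ℕ.∸-monoˡ-≤ (loss W k) (ℕ.+-monoˡ-≤ (gain W k) (label≤ k))

    -- A mirrored `S` or `dE` comes from an `N` or `E` away from `p`. Before `p` the gain makes its
    -- label positive; after `p` the label was positive and is unchanged.
    label>0′ : ∀ k → β (lookup u′ (opposite k)) ≡ false → 0 < lookup c′ (opposite k)
    label>0′ k β≡false rewrite label-mirror W k | β-mirror W k with place k
    ... | at _ _ _ e _ rewrite e = contradiction β≡false λ ()
    ... | before _ b e a rewrite b | e | a with β (lookup u k)
    ...   | true = ℕ.m≤n+m 1 (lookup c k)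
    label>0′ k β≡false | after _ 0<c b e a rewrite b | e | a with β (lookup u k)
    ...   | true = ℕ.≤-trans 0<c (ℕ.m≤m+n _ 0)

  mirror-history : IsHistory W′
  mirror-history = profile⇒history mirror-profile

  -- Effect of the mirror on the statistics

  cs-mirror : cs W ℕ.+ cs W′ ≡ suc (suc m)
  cs-mirror rewrite cs-mirror≡ | cs≡ | Fin.opposite-prop p =
    cong suc (trans (ℕ.+-suc (toℕ p) _) (cong suc (ℕ.m+[n∸m]≡n (ℕ.s≤s⁻¹ (Fin.toℕ<n p)))))

  -- This and the next three lemmas combine the exchange of before and after with the negation of β.
  -- The exception at `p` does no harm, since `p` is counted by none of the four statistics.
  sdeb-mirror : sdeb W′ ≡ nea W
  sdeb-mirror = countFin-reflect (sdeb? W′) (nea? W)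
    λ k → trans (does-sdeb? W′ (opposite k)) (trans (exchange k) (sym (does-nea? W k)))
    where
    exchange : ∀ k → isBefore W′ (opposite k) ∧ not (β (lookup u′ (opposite k))) ≡ isAfter W k ∧ β (lookup u k)
    exchange k rewrite isBefore-mirror k | β-mirror W k with place k
    ... | before _ _ _ a rewrite a = refl
    ... | at _ _ _ _ a rewrite a = refl
    ... | after _ _ _ e _ rewrite e = cong (isAfter W k ∧_) (Bool.not-involutive (β (lookup u k)))

  sdea-mirror : sdea W′ ≡ neb W
  sdea-mirror = countFin-reflect (sdea? W′) (neb? W)
    λ k → trans (does-sdea? W′ (opposite k)) (trans (exchange k) (sym (does-neb? W k)))
    where
    exchange : ∀ k → isAfter W′ (opposite k) ∧ not (β (lookup u′ (opposite k))) ≡ isBefore W k ∧ β (lookup u k)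
    exchange k rewrite isAfter-mirror k | β-mirror W k with place k
    ... | before _ _ e _ rewrite e = cong (isBefore W k ∧_) (Bool.not-involutive (β (lookup u k)))
    ... | at _ _ b _ _ rewrite b = refl
    ... | after _ _ b _ _ rewrite b = refl

  neb-mirror : neb W′ ≡ sdea W
  neb-mirror = countFin-reflect (neb? W′) (sdea? W)
    λ k → trans (does-neb? W′ (opposite k)) (trans (exchange k) (sym (does-sdea? W k)))
    where
    exchange : ∀ k → isBefore W′ (opposite k) ∧ β (lookup u′ (opposite k)) ≡ isAfter W k ∧ not (β (lookup u k))
    exchange k rewrite isBefore-mirror k | β-mirror W k with place k
    ... | before _ _ _ a rewrite a = refl
    ... | at _ _ _ _ a rewrite a = refl
    ... | after _ _ _ e _ rewrite e = refl

  nea-mirror : nea W′ ≡ sdeb W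
  nea-mirror = countFin-reflect (nea? W′) (sdeb? W)
    λ k → trans (does-nea? W′ (opposite k)) (trans (exchange k) (sym (does-sdeb? W k)))
    where
    exchange : ∀ k → isAfter W′ (opposite k) ∧ β (lookup u′ (opposite k)) ≡ isBefore W k ∧ not (β (lookup u k))
    exchange k rewrite isAfter-mirror k | β-mirror W k with place k
    ... | before _ _ e _ rewrite e = refl
    ... | at _ _ b _ _ rewrite b = refl
    ... | after _ _ b _ _ rewrite b = refl

  -- `inject₁ (opposite l)` is `opposite (suc l)` by computation, and the offset in `α′` places
  -- there the negated bit of `inject₁ l`.
  nde-mirror : nde W′ ℕ.+ nde W ≡ m
  nde-mirror = countFin-complement (λ i → lookup u′ (inject₁ i) isNordE?) (λ i → lookup u (inject₁ i) isNordE?)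
    λ l → α-mirror W (suc l)

  -- With [k ≥ p] at `inject₁ l` added to both sides, the ascent condition of the mirror reads
  -- `suc (c (suc l)) ≤ threshold W l`, the failure of an ascent of `W` at `l`.
  asc-mirror : asc W′ ℕ.+ asc W ≡ m
  asc-mirror = countFin-complement (asc? W′) (asc? W) λ l → trans (does-asc? W′ (opposite l))
    (trans (does-⇔ (reversed l) (threshold W′ (opposite l) ℕ.≤? lookup c′ (suc (opposite l)))
                                (¬? (threshold W l ℕ.≤? lookup c (suc l))))
           (cong not (sym (does-asc? W l))))
    where
    reversed : ∀ l → threshold W′ (opposite l) ≤ lookup c′ (suc (opposite l))
                   ⇔ (¬ threshold W l ≤ lookup c (suc l))
    reversed l = mk⇔
      (λ q → ℕ.<⇒≱ (subst₂ _≤_ top bottom (ℕ.+-monoˡ-≤ (fromCs (inject₁ l)) q)))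
      (λ q → ℕ.+-cancelʳ-≤ (fromCs (inject₁ l)) _ _ (subst₂ _≤_ (sym top) (sym bottom) (ℕ.≰⇒> q)))
      where
      top : lookup c′ (opposite (suc l)) ℕ.+ bit (β (lookup u′ (opposite (suc l)))) ℕ.+ fromCs (inject₁ l)
          ≡ suc (lookup c (suc l))
      top = trans (cong₂ (λ x b → x ℕ.+ bit b ℕ.+ fromCs (inject₁ l)) (label-mirror W (suc l)) (β-mirror W (suc l)))
                  (shift+β′-suc (λ _ → ℕ.≤-refl) l)
      bottom : lookup c′ (suc (opposite l)) ℕ.+ fromCs (inject₁ l)
             ≡ lookup c (inject₁ l) ℕ.+ bit (β (lookup u (inject₁ l)))
      bottom = trans (cong (ℕ._+ fromCs (inject₁ l))
                       (trans (cong (lookup c′) (sym (opposite-inject₁ l))) (label-mirror W (inject₁ l))))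
                     (shift+fromCs (λ _ → ℕ.≤-refl) (inject₁ l))

  -- The gains number `neb W` and the losses `sdea W`, whatever `f` is; hence `ht` and `wt` change
  -- by the same amount.
  sum-shift : ∀ {f} → (∀ k → lookup c k ≤ f k) → sumFin (shift W f) ℕ.+ sdea W ≡ sumFin f ℕ.+ neb W
  sum-shift {f} c≤f = begin
    sumFin (shift W f) ℕ.+ sdea W
      ≡⟨ cong (sumFin (shift W f) ℕ.+_) (countFin-sum (sdea? W)) ⟩
    sumFin (shift W f) ℕ.+ sumFin (λ k → bit (does (sdea? W k)))
      ≡⟨ cong (sumFin (shift W f) ℕ.+_) (sumFin-cong loss≡) ⟩
    sumFin (shift W f) ℕ.+ sumFin (loss W)
      ≡⟨ sumFin-+ (shift W f) (loss W) ⟨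
    sumFin (λ k → shift W f k ℕ.+ loss W k)
      ≡⟨ sumFin-cong (shift-spec c≤f) ⟩
    sumFin (λ k → f k ℕ.+ gain W k)
      ≡⟨ sumFin-+ f (gain W) ⟩
    sumFin f ℕ.+ sumFin (gain W)
      ≡⟨ cong (sumFin f ℕ.+_) (trans (countFin-sum (neb? W)) (sumFin-cong gain≡)) ⟨
    sumFin f ℕ.+ neb W ∎
    where
    open ≡-Reasoning
    loss≡ : ∀ k → bit (does (sdea? W k)) ≡ loss W k
    loss≡ k = cong bit (does-sdea? W k)
    gain≡ : ∀ k → bit (does (neb? W k)) ≡ gain W k
    gain≡ k = cong bit (does-neb? W k)

  ht-profile : ∀ {W : Labelled (suc m)} {h} → Profile W h → ht W ≡ sumFin h
  ht-profile P = sumFin-cong (λ i → cong ∣_∣ (height-profile P i))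

  ht-mirror : ht W′ ℕ.+ sdea W ≡ ht W ℕ.+ neb W
  ht-mirror = trans (cong (ℕ._+ sdea W) (trans (ht-profile mirror-profile) (sumFin-opposite (shift W h))))
    (trans (sum-shift label≤) (cong (ℕ._+ neb W) (sym (ht-profile profile))))

  wt-mirror : wt W′ ℕ.+ sdea W ≡ wt W ℕ.+ neb W
  wt-mirror = trans (cong (ℕ._+ sdea W) (trans (sym (sumFin-opposite (lookup c′))) (sumFin-cong (label-mirror W))))
    (sum-shift (λ _ → ℕ.≤-refl))

-- Monomials

mono : Vec ℤ 9 → Laurent 9
mono e = (1ℤ , e) ∷ []

infixr 6 _⊕_
_⊕_ : Vec ℤ 9 → Vec ℤ 9 → Vec ℤ 9
_⊕_ = Vec.zipWith ℤ._+_

infixr 7 _⊗_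
_⊗_ : ℕ → Vec ℤ 9 → Vec ℤ 9
n ⊗ e = Vec.map (ℤ._* + n) e

⊕-assoc : ∀ e f g → (e ⊕ f) ⊕ g ≡ e ⊕ f ⊕ g
⊕-assoc = Vec.zipWith-assoc ℤ.+-assoc

mono-^ : ∀ e n → mono e ^ n ≡ mono (n ⊗ e)
mono-^ e zero    = cong mono (map-*0 e)
  where
  map-*0 : ∀ {k} (e : Vec ℤ k) → Vec.replicate k 0ℤ ≡ Vec.map (ℤ._* 0ℤ) e
  map-*0 []      = refl
  map-*0 (d ∷ e) = cong₂ _∷_ (sym (ℤ.*-zeroʳ d)) (map-*0 e)
mono-^ e (suc n) = trans (cong (mono e *_) (mono-^ e n)) (cong mono (map-*suc e))
  where
  map-*suc : ∀ {k} (e : Vec ℤ k) → Vec.zipWith ℤ._+_ e (Vec.map (ℤ._* + n) e) ≡ Vec.map (ℤ._* + suc n) e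
  map-*suc []      = refl
  map-*suc (d ∷ e) = cong₂ _∷_ (sym (ℤ.*-suc d (+ n))) (map-*suc e)

monos : ∀ {X : Set} → List X → (X → Vec ℤ 9) → Laurent 9
monos Xs g = map (λ a → 1ℤ , g a) Xs

∑-mono : ∀ {X : Set} (Xs : List X) {f : X → Laurent 9} {g} →
         (∀ a → f a ≡ mono (g a)) → ∑ Xs f ≡ monos Xs g
∑-mono []       f≡ = refl
∑-mono (a ∷ Xs) f≡ = cong₂ _+_ (f≡ a) (∑-mono Xs f≡)

mono-*-monos : ∀ {X : Set} e (Xs : List X) g →
               mono e * monos Xs g ≡ monos Xs (λ a → e ⊕ g a)
mono-*-monos e Xs g = trans (List.++-identityʳ _) (sym (List.map-∘ Xs))

-- Nested to the right, the components of the exponent evaluate to at most one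
-- summand 0 on the right once the eᵢ are concrete.
monomial : ∀ a₁ a₂ a₃ a₄ a₅ a₆ a₇ a₈ a₉ e₁ e₂ e₃ e₄ e₅ e₆ e₇ e₈ e₉ →
  mono e₁ ^ a₁ * mono e₂ ^ a₂ * mono e₃ ^ a₃ * mono e₄ ^ a₄ * mono e₅ ^ a₅
    * mono e₆ ^ a₆ * mono e₇ ^ a₇ * mono e₈ ^ a₈ * mono e₉ ^ a₉
  ≡ mono (a₁ ⊗ e₁ ⊕ a₂ ⊗ e₂ ⊕ a₃ ⊗ e₃ ⊕ a₄ ⊗ e₄ ⊕ a₅ ⊗ e₅ ⊕ a₆ ⊗ e₆ ⊕ a₇ ⊗ e₇ ⊕ a₈ ⊗ e₈ ⊕ a₉ ⊗ e₉)
monomial a₁ a₂ a₃ a₄ a₅ a₆ a₇ a₈ a₉ e₁ e₂ e₃ e₄ e₅ e₆ e₇ e₈ e₉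
  rewrite mono-^ e₁ a₁ | mono-^ e₂ a₂ | mono-^ e₃ a₃ | mono-^ e₄ a₄ | mono-^ e₅ a₅
        | mono-^ e₆ a₆ | mono-^ e₇ a₇ | mono-^ e₈ a₈ | mono-^ e₉ a₉
        | ⊕-assoc ((((((a₁ ⊗ e₁ ⊕ a₂ ⊗ e₂) ⊕ a₃ ⊗ e₃) ⊕ a₄ ⊗ e₄) ⊕ a₅ ⊗ e₅) ⊕ a₆ ⊗ e₆) ⊕ a₇ ⊗ e₇) (a₈ ⊗ e₈) (a₉ ⊗ e₉)
        | ⊕-assoc (((((a₁ ⊗ e₁ ⊕ a₂ ⊗ e₂) ⊕ a₃ ⊗ e₃) ⊕ a₄ ⊗ e₄) ⊕ a₅ ⊗ e₅) ⊕ a₆ ⊗ e₆) (a₇ ⊗ e₇) (a₈ ⊗ e₈ ⊕ a₉ ⊗ e₉)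
        | ⊕-assoc ((((a₁ ⊗ e₁ ⊕ a₂ ⊗ e₂) ⊕ a₃ ⊗ e₃) ⊕ a₄ ⊗ e₄) ⊕ a₅ ⊗ e₅) (a₆ ⊗ e₆) (a₇ ⊗ e₇ ⊕ a₈ ⊗ e₈ ⊕ a₉ ⊗ e₉)
        | ⊕-assoc (((a₁ ⊗ e₁ ⊕ a₂ ⊗ e₂) ⊕ a₃ ⊗ e₃) ⊕ a₄ ⊗ e₄) (a₅ ⊗ e₅) (a₆ ⊗ e₆ ⊕ a₇ ⊗ e₇ ⊕ a₈ ⊗ e₈ ⊕ a₉ ⊗ e₉)
        | ⊕-assoc ((a₁ ⊗ e₁ ⊕ a₂ ⊗ e₂) ⊕ a₃ ⊗ e₃) (a₄ ⊗ e₄) (a₅ ⊗ e₅ ⊕ a₆ ⊗ e₆ ⊕ a₇ ⊗ e₇ ⊕ a₈ ⊗ e₈ ⊕ a₉ ⊗ e₉)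
        | ⊕-assoc (a₁ ⊗ e₁ ⊕ a₂ ⊗ e₂) (a₃ ⊗ e₃) (a₄ ⊗ e₄ ⊕ a₅ ⊗ e₅ ⊕ a₆ ⊗ e₆ ⊕ a₇ ⊗ e₇ ⊕ a₈ ⊗ e₈ ⊕ a₉ ⊗ e₉)
        | ⊕-assoc (a₁ ⊗ e₁) (a₂ ⊗ e₂) (a₃ ⊗ e₃ ⊕ a₄ ⊗ e₄ ⊕ a₅ ⊗ e₅ ⊕ a₆ ⊗ e₆ ⊕ a₇ ⊗ e₇ ⊕ a₈ ⊗ e₈ ⊕ a₉ ⊗ e₉) = refl

-- Meant for single terms only.
exponent : Laurent 9 → Vec ℤ 9
exponent []            = Vec.replicate 9 0ℤ
exponent ((_ , e) ∷ _) = e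

monomial-variables : ∀ a₁ a₂ a₃ a₄ a₅ a₆ a₇ a₈ a₉ →
  t₁ ^ a₁ * t₂ ^ a₂ * t₃ ^ a₃ * t₄ ^ a₄ * r ^ a₅ * s ^ a₆ * x ^ a₇ * v ^ a₈ * w ^ a₉
  ≡ mono (+ a₁ ∷ + a₂ ∷ + a₃ ∷ + a₄ ∷ + a₅ ∷ + a₆ ∷ + a₇ ∷ + a₈ ∷ + a₉ ∷ [])
monomial-variables a₁ a₂ a₃ a₄ a₅ a₆ a₇ a₈ a₉
  rewrite monomial a₁ a₂ a₃ a₄ a₅ a₆ a₇ a₈ a₉
            (exponent t₁) (exponent t₂) (exponent t₃) (exponent t₄)
            (exponent r) (exponent s) (exponent x) (exponent v) (exponent w)
        | ℤ.*-identityˡ (+ a₁) | ℤ.*-identityˡ (+ a₂) | ℤ.*-identityˡ (+ a₃)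
        | ℤ.*-identityˡ (+ a₄) | ℤ.*-identityˡ (+ a₅) | ℤ.*-identityˡ (+ a₆)
        | ℤ.*-identityˡ (+ a₇) | ℤ.*-identityˡ (+ a₈) | ℤ.*-identityˡ (+ a₉)
        | ℕ.+-identityʳ a₁ | ℕ.+-identityʳ a₂ | ℕ.+-identityʳ a₃ | ℕ.+-identityʳ a₄
        | ℕ.+-identityʳ a₅ | ℕ.+-identityʳ a₆ | ℕ.+-identityʳ a₇ | ℕ.+-identityʳ a₈ = refl

-- The exponents of `v` and `w` each collect -a₂ from t₃/(vw) and a₃ from vwt₂, besides their own a₈
-- or a₉.
monomial-substituted : ∀ a₁ a₂ a₃ a₄ a₅ a₆ a₇ a₈ a₉ →
  t₄ ^ a₁ * (t₃ * v⁻¹ * w⁻¹) ^ a₂ * (v * w * t₂) ^ a₃ * t₁ ^ a₄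
    * r⁻¹ ^ a₅ * s⁻¹ ^ a₆ * x⁻¹ ^ a₇ * v ^ a₈ * w ^ a₉
  ≡ mono (+ a₄ ∷ + a₃ ∷ + a₂ ∷ + a₁ ∷ ℤ.- + a₅ ∷ ℤ.- + a₆ ∷ ℤ.- + a₇
            ∷ ℤ.- + a₂ ℤ.+ + (a₃ ℕ.+ a₈) ∷ ℤ.- + a₂ ℤ.+ + (a₃ ℕ.+ a₉) ∷ [])
monomial-substituted a₁ a₂ a₃ a₄ a₅ a₆ a₇ a₈ a₉
  rewrite monomial a₁ a₂ a₃ a₄ a₅ a₆ a₇ a₈ a₉
            (exponent t₄) (exponent (t₃ * v⁻¹ * w⁻¹)) (exponent (v * w * t₂))
            (exponent t₁) (exponent r⁻¹) (exponent s⁻¹) (exponent x⁻¹) (exponent v) (exponent w)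
        | ℤ.*-identityˡ (+ a₁) | ℤ.*-identityˡ (+ a₂) | ℤ.*-identityˡ (+ a₃)
        | ℤ.*-identityˡ (+ a₄) | ℤ.*-identityˡ (+ a₈) | ℤ.*-identityˡ (+ a₉)
        | ℕ.+-identityʳ a₁ | ℕ.+-identityʳ a₂ | ℕ.+-identityʳ a₃ | ℕ.+-identityʳ a₄
        | ℕ.+-identityʳ a₈
        | ℤ.-◃n≡-n a₂ | ℤ.-1*i≡-i (+ a₅) | ℤ.-1*i≡-i (+ a₆) | ℤ.-1*i≡-i (+ a₇)
        | ℤ.+-identityʳ (ℤ.- + a₅) | ℤ.+-identityʳ (ℤ.- + a₆) | ℤ.+-identityʳ (ℤ.- + a₇)
        -- Each rewrite removes the innermost zero summand, one for every factor further left: four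
        -- for `r`, five for `s` and six for `x`.
        | ℤ.+-identityˡ (ℤ.- + a₅) | ℤ.+-identityˡ (ℤ.- + a₅) | ℤ.+-identityˡ (ℤ.- + a₅)
        | ℤ.+-identityˡ (ℤ.- + a₅)
        | ℤ.+-identityˡ (ℤ.- + a₆) | ℤ.+-identityˡ (ℤ.- + a₆) | ℤ.+-identityˡ (ℤ.- + a₆)
        | ℤ.+-identityˡ (ℤ.- + a₆) | ℤ.+-identityˡ (ℤ.- + a₆)
        | ℤ.+-identityˡ (ℤ.- + a₇) | ℤ.+-identityˡ (ℤ.- + a₇) | ℤ.+-identityˡ (ℤ.- + a₇)
        | ℤ.+-identityˡ (ℤ.- + a₇) | ℤ.+-identityˡ (ℤ.- + a₇) | ℤ.+-identityˡ (ℤ.- + a₇)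
        | ℤ.+-identityˡ (ℤ.- + a₂ ℤ.+ + (a₃ ℕ.+ a₈))
        | ℤ.+-identityˡ (ℤ.- + a₂ ℤ.+ + (a₃ ℕ.+ a₉)) = refl

-- Both sides of the identity as lists of monomials

statistics : ∀ {m} → Labelled (suc m) → Vec ℤ 9
statistics W = + sdeb W ∷ + sdea W ∷ + neb W ∷ + nea W ∷ + nde W ∷ + asc W ∷ + cs W ∷ + ht W ∷ + wt W ∷ []

-- The exponent contributed by `W` on the right-hand side, from the prefactor x/(rs), from (rsx)ⁿ
-- and from the substituted variables. The sums are left unevaluated to match the product term by
-- term.
substitutedStatistics : ∀ {m} → Labelled (suc m) → Vec ℤ 9
substitutedStatistics {m} W = exponent (x * r⁻¹ * s⁻¹) ⊕ suc m ⊗ exponent (r * s * x) ⊕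
  (+ nea W ∷ + neb W ∷ + sdea W ∷ + sdeb W ∷ ℤ.- + nde W ∷ ℤ.- + asc W ∷ ℤ.- + cs W
   ∷ ℤ.- + sdea W ℤ.+ + (neb W ℕ.+ ht W) ∷ ℤ.- + sdea W ℤ.+ + (neb W ℕ.+ wt W) ∷ [])

A-lhs : ∀ m → A t₁ t₂ t₃ t₄ r s x v w (suc m) ≡ monos (𝔏 (suc m)) statistics
A-lhs m = ∑-mono (𝔏 (suc m)) λ W →
  monomial-variables (sdeb W) (sdea W) (neb W) (nea W) (nde W) (asc W) (cs W) (ht W) (wt W)

A-rhs : ∀ m →
  ((x * r⁻¹ * s⁻¹) · A t₄ (t₃ * v⁻¹ * w⁻¹) (v * w * t₂) t₁ r⁻¹ s⁻¹ x⁻¹ v w [ r * s * x z]) (suc m)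
  ≡ monos (𝔏 (suc m)) substitutedStatistics
A-rhs m = trans
  (cong (x * r⁻¹ * s⁻¹ *_) (trans
    (cong₂ _*_ (mono-^ (exponent (r * s * x)) (suc m)) (∑-mono (𝔏 (suc m)) λ W →
      monomial-substituted (sdeb W) (sdea W) (neb W) (nea W) (nde W) (asc W) (cs W) (ht W) (wt W)))
    (mono-*-monos (suc m ⊗ exponent (r * s * x)) (𝔏 (suc m)) _)))
  (mono-*-monos (exponent (x * r⁻¹ * s⁻¹)) (𝔏 (suc m)) _)

-- Matching the two sides along the involution

module _ {m : ℕ} {W : Labelled (suc m)} (history : IsHistory W) where

  private
    profile = history⇒profile {W = W} history

    -- The initial height 0 forces a zero label, so a last zero label exists.
    c₀≡0 : lookup (proj₂ W) zero ≡ 0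
    c₀≡0 = ℕ.n≤0⇒n≡0 (ℕ.≤-trans (Profile.label≤ profile zero) (ℕ.≤-reflexive (Profile.start profile)))

    module Mirrored = Mirror profile (proj₁ (proj₂ (∃-cs {W = W} zero c₀≡0)))
                                     (proj₂ (proj₂ (∃-cs {W = W} zero c₀≡0)))

  mirror-isHistory : IsHistory (mirror W)
  mirror-isHistory = Mirrored.mirror-history

  mirror-isInvolutive : mirror (mirror W) ≡ W
  mirror-isInvolutive = Mirrored.mirror-involutive

  statistics-mirror : substitutedStatistics W ≡ statistics (mirror W)
  statistics-mirror =
    cong₂ _∷_ (cong +_ (sym sdeb-mirror)) (cong₂ _∷_ (cong +_ (sym sdea-mirror))
    (cong₂ _∷_ (cong +_ (sym neb-mirror)) (cong₂ _∷_ (cong +_ (sym nea-mirror))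
    (cong₂ _∷_ (complement nde-mirror) (cong₂ _∷_ (complement asc-mirror)
    (cong₂ _∷_ (reflect cs-mirror)
    (cong₂ _∷_ (transfer (ht (mirror W)) (sdea W) (ht W) (neb W) ht-mirror)
    (cong₂ _∷_ (transfer (wt (mirror W)) (sdea W) (wt W) (neb W) wt-mirror) refl))))))))
    where
    open Mirrored

    -- For `r` and `s`: the prefactor contributes -1 and (rsx)ⁿ contributes n = `suc m`.
    complement : ∀ {i j} → i ℕ.+ j ≡ m → -1ℤ ℤ.+ (1ℤ ℤ.* + suc m ℤ.+ ℤ.- + j) ≡ + i
    complement {i} {j} refl = identity (+ i) (+ j)
      where
      identity : ∀ i j → -1ℤ ℤ.+ (1ℤ ℤ.* (1ℤ ℤ.+ (i ℤ.+ j)) ℤ.+ ℤ.- j) ≡ i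
      identity = solve-∀

    -- For `x`: here the prefactor contributes +1.
    reflect : ∀ {i j} → i ℕ.+ j ≡ suc (suc m) → 1ℤ ℤ.+ (1ℤ ℤ.* + suc m ℤ.+ ℤ.- + i) ≡ + j
    reflect {i} {j} i+j≡ = trans (regroup (+ suc m) (+ i))
      (trans (cong (λ k → + k ℤ.+ ℤ.- + i) (sym i+j≡)) (cancel (+ i) (+ j)))
      where
      regroup : ∀ k i → 1ℤ ℤ.+ (1ℤ ℤ.* k ℤ.+ ℤ.- i) ≡ 1ℤ ℤ.+ k ℤ.+ ℤ.- i
      regroup = solve-∀
      cancel : ∀ i j → i ℤ.+ j ℤ.+ ℤ.- i ≡ j
      cancel = solve-∀

    -- For `v` and `w`: the two zeros are their exponents in the prefactor and in (rsx)ⁿ.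
    transfer : ∀ i j k l → i ℕ.+ j ≡ k ℕ.+ l → 0ℤ ℤ.+ (0ℤ ℤ.+ (ℤ.- + j ℤ.+ + (l ℕ.+ k))) ≡ + i
    transfer i j k l i+j≡ = trans
      (cong (λ n → 0ℤ ℤ.+ (0ℤ ℤ.+ (ℤ.- + j ℤ.+ + n))) (trans (ℕ.+-comm l k) (sym i+j≡)))
      (cancel (+ i) (+ j))
      where
      cancel : ∀ i j → 0ℤ ℤ.+ (0ℤ ℤ.+ (ℤ.- j ℤ.+ (i ℤ.+ j))) ≡ i
      cancel = solve-∀

mirror-↭ : ∀ m → map mirror (𝔏 (suc m)) ↭ 𝔏 (suc m)
mirror-↭ m = involution⇒↭ (𝔏-unique (suc m))
  (λ {W} W∈ → Equivalence.from (∈-𝔏 (mirror W)) (mirror-isHistory {W = W} (history W∈)))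
  (λ {W} W∈ → mirror-isInvolutive {W = W} (history W∈))
  where
  history : ∀ {W} → W ∈ 𝔏 (suc m) → IsHistory W
  history {W} = Equivalence.to (∈-𝔏 W)

corollary1p1 : A t₁ t₂ t₃ t₄ r s x v w
    ≋ (x * r⁻¹ * s⁻¹) · A t₄ (t₃ * v⁻¹ * w⁻¹) (v * w * t₂) t₁ r⁻¹ s⁻¹ x⁻¹ v w [ r * s * x z]
-- Both series start at n = 1.
corollary1p1 zero    e = refl
corollary1p1 (suc m) e = begin
  coeff (A t₁ t₂ t₃ t₄ r s x v w (suc m)) e
    ≡⟨ cong (λ p → coeff p e) (A-lhs m) ⟩
  coeff (monos (𝔏 (suc m)) statistics) e
    -- The sum over histories is reindexed along `mirror`.
    ≡⟨ coeff-↭ (↭.map⁺ (λ W → 1ℤ , statistics W) (mirror-↭ m)) e ⟨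
  coeff (monos (map mirror (𝔏 (suc m))) statistics) e
    ≡⟨ cong (λ p → coeff p e) (List.map-∘ {g = λ W → 1ℤ , statistics W} {f = mirror} (𝔏 (suc m))) ⟨
  coeff (monos (𝔏 (suc m)) (λ W → statistics (mirror W))) e
    ≡⟨ cong (λ p → coeff p e) (List.map-cong-local (All.tabulate matched)) ⟨
  coeff (monos (𝔏 (suc m)) substitutedStatistics) e
    ≡⟨ cong (λ p → coeff p e) (A-rhs m) ⟨
  coeff (((x * r⁻¹ * s⁻¹) · A t₄ (t₃ * v⁻¹ * w⁻¹) (v * w * t₂) t₁ r⁻¹ s⁻¹ x⁻¹ v w [ r * s * x z]) (suc m)) e ∎
  where
  open ≡-Reasoning
  matched : ∀ {W} → W ∈ 𝔏 (suc m) → (1ℤ , substitutedStatistics W) ≡ (1ℤ , statistics (mirror W))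
  matched {W} W∈ = cong (1ℤ ,_) (statistics-mirror {W = W} (Equivalence.to (∈-𝔏 W) W∈))
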